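{- Let $k$ be a positive integer and let $G$ be a $k$-connected $\Delta$-regular graph of order $n$. If $H$ is a proper subgraph of $G$, then $$\Delta-\lambda_{1}(H)>\frac{k^{2}}{(n-\Delta-1)(n-\Delta+2k-2)+nk^{2}}.$$
   Context: All graphs are finite and simple, with nonempty vertex set. The order of $G$ is its number of vertices. $\lambda_1(H)$ denotes the spectral radius of $H$, i.e. the largest eigenvalue of its adjacency matrix. A proper subgraph of $G$ is a subgraph (not necessarily spanning, induced or connected) different from $G$. A graph is $k$-connected in the usual (vertex-connectivity) sense: it has more than $k$ vertices and remains connected after removal of any fewer than $k$ vertices. -}

module Defs where

open import Data.Bool.Base using (Bool; T; if_then_else_)
open import Data.Fin.Base using (Fin)
open import Data.Fin.Subset using (Subset; ∣_∣; _∉_)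
open import Data.Integer.Base using (+_)
open import Data.Nat.Base as ℕ using (ℕ; NonZero)
import Data.Nat.Properties as ℕ
open import Data.Product.Base using (∃; _×_; _,_)
open import Data.Rational.Base as ℚ
  using (ℚ; 0ℚ; 1ℚ; ½; Positive; positive; 1/_)
import Data.Rational.Properties as ℚ
open import Data.Rational.Solver using (module +-*-Solver)
open import Data.Vec.Base using (tabulate)
open import Data.Vec.Functional using (Vector; foldr)
open import Function.Definitions using (Injective)
open import Relation.Binary.Construct.Closure.ReflexiveTransitive using (Star)
open import Relation.Binary.PropositionalEquality
  using (_≡_; refl; sym; trans; cong; cong₂; subst)
open import Relation.Nullary using (¬_)

-- The reals are Cauchy sequences of rationals, with the setoid equality
-- "the difference tends to 0".

Close : (ε x y : ℚ) → Set
Close ε x y = ℚ.∣ x ℚ.- y ∣ ℚ.< ε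

Settles : ℚ → (ℕ → ℚ) → Set
Settles ε x = ∃ λ N → ∀ m n → N ℕ.≤ m → N ℕ.≤ n → Close ε (x m) (x n)

Cauchy : (ℕ → ℚ) → Set
Cauchy x = ∀ ε → 0ℚ ℚ.< ε → Settles ε x

record ℝ : Set where
  constructor mkℝ
  field
    seq    : ℕ → ℚ
    cauchy : Cauchy seq

open ℝ public

private
  diff-+ : ∀ a b c d → (a ℚ.+ b) ℚ.- (c ℚ.+ d) ≡ (a ℚ.- c) ℚ.+ (b ℚ.- d)
  diff-+ = solve 4 (λ a b c d → (a :+ b) :- (c :+ d) := (a :- c) :+ (b :- d)) refl
    where open +-*-Solver

  diff-neg : ∀ a b → (ℚ.- a) ℚ.- (ℚ.- b) ≡ ℚ.- (a ℚ.- b)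
  diff-neg = solve 2 (λ a b → (:- a) :- (:- b) := :- (a :- b)) refl
    where open +-*-Solver

  diff-* : ∀ a b c d → (a ℚ.* b) ℚ.- (c ℚ.* d) ≡ a ℚ.* (b ℚ.- d) ℚ.+ d ℚ.* (a ℚ.- c)
  diff-* = solve 4 (λ a b c d →
    (a :* b) :- (c :* d) := a :* (b :- d) :+ d :* (a :- c)) refl
    where open +-*-Solver

  split : ∀ a b → a ≡ (a ℚ.- b) ℚ.+ b
  split = solve 2 (λ a b → a := (a :- b) :+ b) refl
    where open +-*-Solver

  halves : ∀ ε → ½ ℚ.* ε ℚ.+ ½ ℚ.* ε ≡ ε
  halves ε = trans (sym (ℚ.*-distribʳ-+ ε ½ ½)) (ℚ.*-identityˡ ε)

  half-pos : ∀ {ε} → 0ℚ ℚ.< ε → 0ℚ ℚ.< ½ ℚ.* ε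
  half-pos {ε} 0<ε = subst (ℚ._< ½ ℚ.* ε) (ℚ.*-zeroʳ ½) (ℚ.*-monoʳ-<-pos ½ 0<ε)

  Bounded : (ℕ → ℚ) → Set
  Bounded x = ∃ λ B → ∃ λ N → 0ℚ ℚ.< B × (∀ n → N ℕ.≤ n → ℚ.∣ x n ∣ ℚ.≤ B)

  bounded : ∀ x → Cauchy x → Bounded x
  bounded x cx with cx 1ℚ (ℚ.positive⁻¹ 1ℚ)
  ... | N , close = 1ℚ ℚ.+ ℚ.∣ x N ∣ , N
      , ℚ.+-mono-<-≤ (ℚ.positive⁻¹ 1ℚ) (ℚ.0≤∣p∣ (x N))
      , λ n N≤n → begin
          ℚ.∣ x n ∣                          ≡⟨ cong ℚ.∣_∣ (split (x n) (x N)) ⟩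
          ℚ.∣ (x n ℚ.- x N) ℚ.+ x N ∣        ≤⟨ ℚ.∣p+q∣≤∣p∣+∣q∣ (x n ℚ.- x N) (x N) ⟩
          ℚ.∣ x n ℚ.- x N ∣ ℚ.+ ℚ.∣ x N ∣    ≤⟨ ℚ.+-monoˡ-≤ ℚ.∣ x N ∣
                                                 (ℚ.<⇒≤ (close n N N≤n ℕ.≤-refl)) ⟩
          1ℚ ℚ.+ ℚ.∣ x N ∣                   ∎
    where open ℚ.≤-Reasoning

  const-cauchy : ∀ q → Cauchy (λ _ → q)
  const-cauchy q ε 0<ε = 0 , λ _ _ _ _ →
    subst (λ d → ℚ.∣ d ∣ ℚ.< ε) (sym (ℚ.+-inverseʳ q)) 0<ε

  +-cauchy : ∀ x y → Cauchy x → Cauchy y → Cauchy (λ n → x n ℚ.+ y n)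
  +-cauchy x y cx cy ε 0<ε with cx (½ ℚ.* ε) (half-pos 0<ε) | cy (½ ℚ.* ε) (half-pos 0<ε)
  ... | M , p | N , q = M ℕ.⊔ N , λ m n ≤m ≤n → begin-strict
      ℚ.∣ (x m ℚ.+ y m) ℚ.- (x n ℚ.+ y n) ∣
        ≡⟨ cong ℚ.∣_∣ (diff-+ (x m) (y m) (x n) (y n)) ⟩
      ℚ.∣ (x m ℚ.- x n) ℚ.+ (y m ℚ.- y n) ∣
        ≤⟨ ℚ.∣p+q∣≤∣p∣+∣q∣ (x m ℚ.- x n) (y m ℚ.- y n) ⟩
      ℚ.∣ x m ℚ.- x n ∣ ℚ.+ ℚ.∣ y m ℚ.- y n ∣
        <⟨ ℚ.+-mono-< (p m n (ℕ.m⊔n≤o⇒m≤o M N ≤m) (ℕ.m⊔n≤o⇒m≤o M N ≤n))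
                      (q m n (ℕ.m⊔n≤o⇒n≤o M N ≤m) (ℕ.m⊔n≤o⇒n≤o M N ≤n)) ⟩
      ½ ℚ.* ε ℚ.+ ½ ℚ.* ε
        ≡⟨ halves ε ⟩
      ε ∎
    where open ℚ.≤-Reasoning

  neg-cauchy : ∀ x → Cauchy x → Cauchy (λ n → ℚ.- x n)
  neg-cauchy x cx ε 0<ε with cx ε 0<ε
  ... | N , p = N , λ m n ≤m ≤n →
    subst (ℚ._< ε)
      (sym (trans (cong ℚ.∣_∣ (diff-neg (x m) (x n))) (ℚ.∣-p∣≡∣p∣ (x m ℚ.- x n))))
      (p m n ≤m ≤n)

  *-bound : ∀ {B a d δ} → 0ℚ ℚ.< B → ℚ.∣ a ∣ ℚ.≤ B → ℚ.∣ d ∣ ℚ.< δ →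
            ℚ.∣ a ℚ.* d ∣ ℚ.< B ℚ.* δ
  *-bound {B} {a} {d} {δ} 0<B a≤B d<δ = begin-strict
      ℚ.∣ a ℚ.* d ∣        ≡⟨ ℚ.∣p*q∣≡∣p∣*∣q∣ a d ⟩
      ℚ.∣ a ∣ ℚ.* ℚ.∣ d ∣  ≤⟨ ℚ.*-monoʳ-≤-nonNeg ℚ.∣ d ∣ {{ℚ.∣-∣-nonNeg d}} a≤B ⟩
      B ℚ.* ℚ.∣ d ∣        <⟨ ℚ.*-monoʳ-<-pos B {{positive 0<B}} d<δ ⟩
      B ℚ.* δ              ∎
    where open ℚ.≤-Reasoning

  quotient : ∀ D ε → 0ℚ ℚ.< D → 0ℚ ℚ.< ε → ∃ λ δ → 0ℚ ℚ.< δ × D ℚ.* δ ≡ ε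
  quotient D ε 0<D 0<ε = D⁻¹ ℚ.* ε
    , subst (ℚ._< D⁻¹ ℚ.* ε) (ℚ.*-zeroʳ D⁻¹) (ℚ.*-monoʳ-<-pos D⁻¹ {{ℚ.1/pos⇒pos D}} 0<ε)
    , trans (sym (ℚ.*-assoc D D⁻¹ ε))
            (trans (cong (ℚ._* ε) (ℚ.*-inverseʳ D)) (ℚ.*-identityˡ ε))
    where
    instance
      D-positive : Positive D
      D-positive = positive 0<D
      D-nonZero : ℚ.NonZero D
      D-nonZero = ℚ.pos⇒nonZero D
    D⁻¹ : ℚ
    D⁻¹ = 1/ D

  *-close : ∀ {B C δ ε} a b c d → 0ℚ ℚ.< B → 0ℚ ℚ.< C → (B ℚ.+ C) ℚ.* δ ≡ ε →
            ℚ.∣ a ∣ ℚ.≤ B → ℚ.∣ d ∣ ℚ.≤ C → Close δ a c → Close δ b d →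
            Close ε (a ℚ.* b) (c ℚ.* d)
  *-close {B} {C} {δ} {ε} a b c d 0<B 0<C eq a≤B d≤C a~c b~d = begin-strict
      ℚ.∣ a ℚ.* b ℚ.- c ℚ.* d ∣
        ≡⟨ cong ℚ.∣_∣ (diff-* a b c d) ⟩
      ℚ.∣ a ℚ.* (b ℚ.- d) ℚ.+ d ℚ.* (a ℚ.- c) ∣
        ≤⟨ ℚ.∣p+q∣≤∣p∣+∣q∣ (a ℚ.* (b ℚ.- d)) (d ℚ.* (a ℚ.- c)) ⟩
      ℚ.∣ a ℚ.* (b ℚ.- d) ∣ ℚ.+ ℚ.∣ d ℚ.* (a ℚ.- c) ∣
        <⟨ ℚ.+-mono-< (*-bound {a = a} {d = b ℚ.- d} 0<B a≤B b~d)
                      (*-bound {a = d} {d = a ℚ.- c} 0<C d≤C a~c) ⟩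
      B ℚ.* δ ℚ.+ C ℚ.* δ
        ≡⟨ sym (ℚ.*-distribʳ-+ δ B C) ⟩
      (B ℚ.+ C) ℚ.* δ
        ≡⟨ eq ⟩
      ε ∎
    where open ℚ.≤-Reasoning

  *-cauchy : ∀ x y → Cauchy x → Cauchy y → Cauchy (λ n → x n ℚ.* y n)
  *-cauchy x y cx cy ε 0<ε = bounds (bounded x cx) (bounded y cy)
    where
    Result : Set
    Result = Settles ε (λ n → x n ℚ.* y n)

    module _ (B C δ : ℚ) (0<B : 0ℚ ℚ.< B) (0<C : 0ℚ ℚ.< C) (eq : (B ℚ.+ C) ℚ.* δ ≡ ε)
             (K L : ℕ) (x≤B : ∀ n → K ℕ.≤ n → ℚ.∣ x n ∣ ℚ.≤ B)
             (y≤C : ∀ n → L ℕ.≤ n → ℚ.∣ y n ∣ ℚ.≤ C) where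

      combine : Settles δ x → Settles δ y → Result
      combine (M , p) (N , q) = (K ℕ.⊔ L) ℕ.⊔ (M ℕ.⊔ N) , λ m n ≤m ≤n →
        let KL≤m = ℕ.m⊔n≤o⇒m≤o (K ℕ.⊔ L) (M ℕ.⊔ N) ≤m
            KL≤n = ℕ.m⊔n≤o⇒m≤o (K ℕ.⊔ L) (M ℕ.⊔ N) ≤n
            MN≤m = ℕ.m⊔n≤o⇒n≤o (K ℕ.⊔ L) (M ℕ.⊔ N) ≤m
            MN≤n = ℕ.m⊔n≤o⇒n≤o (K ℕ.⊔ L) (M ℕ.⊔ N) ≤n
        in *-close {B} {C} {δ} {ε} (x m) (y m) (x n) (y n) 0<B 0<C eq
             (x≤B m (ℕ.m⊔n≤o⇒m≤o K L KL≤m))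
             (y≤C n (ℕ.m⊔n≤o⇒n≤o K L KL≤n))
             (p m n (ℕ.m⊔n≤o⇒m≤o M N MN≤m) (ℕ.m⊔n≤o⇒m≤o M N MN≤n))
             (q m n (ℕ.m⊔n≤o⇒n≤o M N MN≤m) (ℕ.m⊔n≤o⇒n≤o M N MN≤n))

    bounds : Bounded x → Bounded y → Result
    bounds (B , K , 0<B , x≤B) (C , L , 0<C , y≤C) =
      scale (quotient (B ℚ.+ C) ε (ℚ.+-mono-< {0ℚ} {B} {0ℚ} {C} 0<B 0<C) 0<ε)
      where
      scale : (∃ λ δ → 0ℚ ℚ.< δ × (B ℚ.+ C) ℚ.* δ ≡ ε) → Result
      scale (δ , 0<δ , eq) =
        combine B C δ 0<B 0<C eq K L x≤B y≤C (cx δ 0<δ) (cy δ 0<δ)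

infix  4 _≈ᴿ_ _<ᴿ_ _≤ᴿ_
infixl 6 _+ᴿ_ _-ᴿ_
infixl 7 _*ᴿ_
infix  8 -ᴿ_

_≈ᴿ_ : ℝ → ℝ → Set
x ≈ᴿ y = ∀ ε → 0ℚ ℚ.< ε → ∃ λ N → ∀ n → N ℕ.≤ n → Close ε (seq x n) (seq y n)

_<ᴿ_ : ℝ → ℝ → Set
x <ᴿ y = ∃ λ ε → 0ℚ ℚ.< ε × ∃ λ N → ∀ n → N ℕ.≤ n → seq x n ℚ.+ ε ℚ.< seq y n

_≤ᴿ_ : ℝ → ℝ → Set
x ≤ᴿ y = ¬ (y <ᴿ x)

fromℚ : ℚ → ℝ
fromℚ q = mkℝ (λ _ → q) (const-cauchy q)

fromℕ : ℕ → ℝ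
fromℕ n = fromℚ (+ n ℚ./ 1)

0ᴿ 1ᴿ : ℝ
0ᴿ = fromℚ 0ℚ
1ᴿ = fromℚ 1ℚ

_+ᴿ_ : ℝ → ℝ → ℝ
x +ᴿ y = mkℝ (λ n → seq x n ℚ.+ seq y n) (+-cauchy (seq x) (seq y) (cauchy x) (cauchy y))

-ᴿ_ : ℝ → ℝ
-ᴿ x = mkℝ (λ n → ℚ.- seq x n) (neg-cauchy (seq x) (cauchy x))

_-ᴿ_ : ℝ → ℝ → ℝ
x -ᴿ y = x +ᴿ (-ᴿ y)

_*ᴿ_ : ℝ → ℝ → ℝ
x *ᴿ y = mkℝ (λ n → seq x n ℚ.* seq y n) (*-cauchy (seq x) (seq y) (cauchy x) (cauchy y))

Matrix : ℕ → Set
Matrix n = Vector (Vector ℝ n) n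

sum : ∀ {n} → Vector ℝ n → ℝ
sum = foldr _+ᴿ_ 0ᴿ

_·_ : ∀ {n} → Matrix n → Vector ℝ n → Vector ℝ n
(A · v) i = sum λ j → A i j *ᴿ v j

-- Only real eigenvalues are considered; this loses nothing for the symmetric
-- matrices used below.
IsEigenvalue : ∀ {n} → Matrix n → ℝ → Set
IsEigenvalue {n} A μ = ∃ λ (v : Vector ℝ n) →
  ¬ (∀ i → v i ≈ᴿ 0ᴿ) × (∀ i → (A · v) i ≈ᴿ μ *ᴿ v i)

IsLargestEigenvalue : ∀ {n} → Matrix n → ℝ → Set
IsLargestEigenvalue A μ = IsEigenvalue A μ × (∀ ν → IsEigenvalue A ν → ν ≤ᴿ μ)

record Graph : Set where
  field
    order         : ℕ
    {{nonempty}}  : NonZero order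
    adj           : Fin order → Fin order → Bool

  Vertex : Set
  Vertex = Fin order

  Adjacent : Vertex → Vertex → Set
  Adjacent u v = T (adj u v)

  field
    symmetric   : ∀ {u v} → Adjacent u v → Adjacent v u
    irreflexive : ∀ {v} → ¬ Adjacent v v

  neighbours : Vertex → Subset order
  neighbours v = tabulate (adj v)

  degree : Vertex → ℕ
  degree v = ∣ neighbours v ∣

  adjacencyMatrix : Matrix order
  adjacencyMatrix u v = if adj u v then 1ᴿ else 0ᴿ

open Graph public using (order)

Regular : ℕ → Graph → Set
Regular Δ G = ∀ v → degree v ≡ Δ
  where open Graph G

AdjacentOutside : (G : Graph) → Subset (order G) → Fin (order G) → Fin (order G) → Set
AdjacentOutside G S u v = u ∉ S × v ∉ S × Graph.Adjacent G u v

-- G − S is connected, the vertices of G − S being those outside S.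
ConnectedOutside : (G : Graph) → Subset (order G) → Set
ConnectedOutside G S = ∀ u v → u ∉ S → v ∉ S → Star (AdjacentOutside G S) u v

Connected[_] : ℕ → Graph → Set
Connected[ k ] G =
  k ℕ.< order G × (∀ (S : Subset (order G)) → ∣ S ∣ ℕ.< k → ConnectedOutside G S)

-- A subgraph is a graph H with its own labelling of the vertices, together
-- with the inclusion of its vertices into those of G.
record Subgraph (G : Graph) : Set where
  field
    graph      : Graph
    ι          : Graph.Vertex graph → Graph.Vertex G
    injective  : Injective _≡_ _≡_ ι
    edges      : ∀ {u v} → Graph.Adjacent graph u v → Graph.Adjacent G (ι u) (ι v)

-- H = G as subgraphs of G.
IsWhole : ∀ {G} → Subgraph G → Set
IsWhole {G} H =
  (∀ w → ∃ λ u → ι u ≡ w) ×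
  (∀ {u v} → Graph.Adjacent G (ι u) (ι v) → Graph.Adjacent graph u v)
  where open Subgraph H

IsProper : ∀ {G} → Subgraph G → Set
IsProper H = ¬ IsWhole H

IsSpectralRadius : Graph → ℝ → Set
IsSpectralRadius H = IsLargestEigenvalue (Graph.adjacencyMatrix H)

-- The subtractions never truncate when Δ < n and 1 ≤ k; a Δ-regular graph of
-- order n has Δ < n.
denominator : (n Δ k : ℕ) → ℕ
denominator n Δ k =
  (n ℕ.∸ Δ ℕ.∸ 1) ℕ.* (n ℕ.∸ Δ ℕ.+ 2 ℕ.* k ℕ.∸ 2) ℕ.+ n ℕ.* k ℕ.^ 2

denominator-nonZero : ∀ n Δ k → .{{NonZero n}} → .{{NonZero k}} → NonZero (denominator n Δ k)
denominator-nonZero n Δ k = ℕ.>-nonZero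
  (ℕ.<-≤-trans (ℕ.>-nonZero⁻¹ (n ℕ.* k ℕ.^ 2)) (ℕ.m≤n+m (n ℕ.* k ℕ.^ 2) _))
  where
  instance
    k²-nonZero : NonZero (k ℕ.^ 2)
    k²-nonZero = ℕ.m^n≢0 k 2
    nk²-nonZero : NonZero (n ℕ.* k ℕ.^ 2)
    nk²-nonZero = ℕ.m*n≢0 n (k ℕ.^ 2)

bound : (n Δ k : ℕ) → .{{NonZero n}} → .{{NonZero k}} → ℚ
bound n Δ k = ((+ (k ℕ.^ 2)) ℚ./ denominator n Δ k) {{denominator-nonZero n Δ k}}

{-# OPTIONS --safe #-}

-- H misses an edge uv of G. For a nonnegative vector x on V(G) supported on V(H), twice
-- Δ∑x² − xᵀA(H)x is at least Q = ∑(x_a − x_b)² + 4x_u x_v, the sum running over ordered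
-- pairs of adjacent vertices of G. Let x_u ≤ x_v. Then Q controls two parts of ∑x²:
--   * the closed neighbourhood of u, where 8∑x² ≤ (4Δ + 3)Q edge by edge;
--   * every other vertex i, where 2k²x_i² ≤ (k² + D)Q with D = n − Δ + 2k − 2: by Menger there
--     is a flow of k internally disjoint paths from u to i meeting only k neighbours of u,
--     hence with at most D edges, and the Cauchy–Schwarz inequality (Thomson's principle)
--     bounds the potential difference x_i − x_u by the energy.
-- With d the denominator of the bound, the sum over all vertices is 8k²∑x² ≤ (4d − k²)Q,
-- which is the bound with room to spare. The flow comes from a transportation version of
-- Hall's theorem on the bipartite double of V(G), where every vertex may also ship to itself,
-- that is, stay unused.

module Submission where

open import Defs
open import Algebra.Bundles using (CommutativeRing)
open import Data.Bool.Base using (Bool; true; false; if_then_else_; _∧_; _∨_)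
open import Data.Bool.Properties using (T?)
open import Data.Fin.Base using (Fin; zero; suc; fromℕ<)
import Data.Fin.Properties as Fin
open import Data.Fin.Subset using (Subset; _∈_; _∉_; _∪_; _∩_; ∁; ⁅_⁆)
  renaming (⊥ to ∅; ∣_∣ to card)
open import Data.Fin.Subset.Properties as Subset using (_∈?_; anySubset?)
import Data.Integer.Base as ℤ
import Data.Integer.Properties as ℤ
open import Data.List.Base using (List; []; _∷_; allFin)
open import Data.List.Membership.Propositional using () renaming (_∈_ to _∈ˡ_)
open import Data.List.Membership.Propositional.Properties using (∈-allFin)
open import Data.List.Relation.Unary.Any using (here; there)
open import Data.Nat.Base as ℕ using (ℕ; zero; suc; NonZero)
import Data.Nat.Properties as ℕ
open import Data.Nat.Solver using () renaming (module +-*-Solver to ℕ-Solver)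
open import Data.Product.Base using (∃; _×_; _,_; proj₁; proj₂)
open import Data.Rational.Base as ℚ hiding (NonZero)
import Data.Rational.Properties as ℚ
open import Data.Rational.Solver using (module +-*-Solver)
import Data.Rational.Unnormalised.Base as ℚᵘ
import Data.Rational.Unnormalised.Properties as ℚᵘ
open import Data.Sum.Base using (_⊎_; inj₁; inj₂; [_,_]′)
open import Data.Unit.Base using (tt)
open import Data.Vec.Base using (lookup; []; _∷_)
import Data.Vec.Properties as Vec
open import Function.Base using (_∘_)
open import Relation.Binary.Construct.Closure.ReflexiveTransitive
  using (Star; _◅_) renaming (ε to stop)
open import Relation.Binary.PropositionalEquality
  using (_≡_; _≢_; refl; sym; trans; cong; cong₂; subst; subst₂; module ≡-Reasoning)
open import Relation.Nullary using (¬_; Dec; yes; no; does)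
open import Relation.Nullary.Decidable
  using (_→-dec_; _×-dec_; _⊎-dec_; ¬?; decidable-stable)
open import Relation.Nullary.Negation using (contradiction)
import Algebra.Properties.Semiring.Sum ℕ.+-*-semiring as ΣN
import Algebra.Properties.Semiring.Sum (CommutativeRing.semiring ℚ.+-*-commutativeRing) as ΣQ

-- Reals are constructive Cauchy sequences and an eigenvector is only known not to vanish, so it
-- cannot be normalised or made nonnegative. Hence the main estimate concerns all rational vectors:
-- xᵀA(H)x ≤ (Δ - γ)∑x², where γ = c + c²/4 and c is the bound of the theorem. Real eigenvalues meet
-- it only at the end, through the residual Ay - μy. The margin c²/4 pays for this approximation and
-- for strictness; it comes from the -k² in 4d - k², that is, from having 4Δ + 3 and not 4Δ + 4 on
-- the closed neighbourhood.
--
-- The value of D is a count. Internally disjoint paths that meet at most k of the Δ neighbours of u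
-- have at most n - 2 - (Δ - k) internal vertices, and k paths have k more edges than internal
-- vertices. The flow may also contain cycles; charging each edge to its head covers them in the
-- same count.
--
-- The order x_u ≤ x_v turns the term of the missing edge into a multiple of x_u². Without it the
-- energy alone controls nothing, since it vanishes on constant vectors.

-- The transportation form of Hall's theorem

-- Opaque, so that unification can read off the summand.
opaque
  ∑ℕ : ∀ {n} → (Fin n → ℕ) → ℕ
  ∑ℕ = ΣN.sum

  ∑ℕ-cong : ∀ {n} {f g : Fin n → ℕ} → (∀ i → f i ≡ g i) → ∑ℕ f ≡ ∑ℕ g
  ∑ℕ-cong = ΣN.sum-cong-≗

  ∑ℕ-+ : ∀ {n} (f g : Fin n → ℕ) → ∑ℕ (λ i → f i ℕ.+ g i) ≡ ∑ℕ f ℕ.+ ∑ℕ g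
  ∑ℕ-+ = ΣN.∑-distrib-+

  ∑ℕ-*ˡ : ∀ {n} c (f : Fin n → ℕ) → ∑ℕ (λ i → c ℕ.* f i) ≡ c ℕ.* ∑ℕ f
  ∑ℕ-*ˡ c f = sym (ΣN.*-distribˡ-sum c f)

  ∑ℕ-zero : ∀ n → ∑ℕ {n} (λ _ → 0) ≡ 0
  ∑ℕ-zero = ΣN.sum-replicate-zero

  ∑ℕ-one : ∀ n → ∑ℕ {n} (λ _ → 1) ≡ n
  ∑ℕ-one zero    = refl
  ∑ℕ-one (suc n) = cong suc (∑ℕ-one n)

  ∑ℕ-mono : ∀ {n} {f g : Fin n → ℕ} → (∀ i → f i ℕ.≤ g i) → ∑ℕ f ℕ.≤ ∑ℕ g
  ∑ℕ-mono {zero}  f≤g = ℕ.z≤n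
  ∑ℕ-mono {suc n} f≤g = ℕ.+-mono-≤ (f≤g zero) (∑ℕ-mono (λ i → f≤g (suc i)))

  entry≤∑ℕ : ∀ {n} (f : Fin n → ℕ) i → f i ℕ.≤ ∑ℕ f
  entry≤∑ℕ f zero    = ℕ.m≤m+n _ _
  entry≤∑ℕ f (suc i) = ℕ.≤-trans (entry≤∑ℕ (λ j → f (suc j)) i) (ℕ.m≤n+m _ _)

  positive-entry : ∀ {n} (f : Fin n → ℕ) → 0 ℕ.< ∑ℕ f → ∃ λ i → 0 ℕ.< f i
  positive-entry {suc n} f 0<∑ with f zero in eq
  ... | suc _ = zero , subst (0 ℕ.<_) (sym eq) (ℕ.s≤s ℕ.z≤n)
  ... | zero with positive-entry (λ i → f (suc i)) 0<∑
  ...   | i , 0<fi = suc i , 0<fi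

δ : ∀ {n} → Fin n → Fin n → ℕ
δ i j = if does (i Fin.≟ j) then 1 else 0

δ-refl : ∀ {n} (i : Fin n) → δ i i ≡ 1
δ-refl i with i Fin.≟ i
... | yes _  = refl
... | no i≢i = contradiction refl i≢i

δ-≢ : ∀ {n} {i j : Fin n} → i ≢ j → δ i j ≡ 0
δ-≢ {i = i} {j} i≢j with i Fin.≟ j
... | yes i≡j = contradiction i≡j i≢j
... | no  _   = refl

δ-suc : ∀ {n} (i j : Fin n) → δ (suc i) (suc j) ≡ δ i j
δ-suc i j with i Fin.≟ j
... | yes _ = refl
... | no  _ = refl

opaque
  unfolding ∑ℕ

  ∑ℕ-δ : ∀ {n} (i : Fin n) (f : Fin n → ℕ) → ∑ℕ (λ j → δ i j ℕ.* f j) ≡ f i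
  ∑ℕ-δ {suc n} zero f =
    trans (cong₂ ℕ._+_ (ℕ.+-identityʳ _) (∑ℕ-zero n)) (ℕ.+-identityʳ _)
  ∑ℕ-δ {suc n} (suc i) f =
    trans (∑ℕ-cong (λ j → cong (ℕ._* f (suc j)) (δ-suc i j))) (∑ℕ-δ i (λ j → f (suc j)))

∑ℕ-δ-one : ∀ {n} (i : Fin n) → ∑ℕ (δ i) ≡ 1
∑ℕ-δ-one i = trans (∑ℕ-cong (λ j → sym (ℕ.*-identityʳ (δ i j)))) (∑ℕ-δ i (λ _ → 1))

∉⇒lookup : ∀ {n} {J : Subset n} {a} → a ∉ J → lookup J a ≡ false
∉⇒lookup {J = J} {a} a∉J with lookup J a in eq
... | true  = contradiction (Vec.lookup⇒[]= a J eq) a∉J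
... | false = refl

on : Bool → ℕ → ℕ
on b m = if b then m else 0

weight : ∀ {n} → (Fin n → ℕ) → Subset n → ℕ
weight s J = ∑ℕ λ a → on (lookup J a) (s a)

-- Modularity drives the uncrossing in `merge`; for disjoint sets it is additivity.
weight-∪-∩ : ∀ {n} (s : Fin n → ℕ) J K →
  weight s (J ∪ K) ℕ.+ weight s (J ∩ K) ≡ weight s J ℕ.+ weight s K
weight-∪-∩ s J K = begin
  weight s (J ∪ K) ℕ.+ weight s (J ∩ K) ≡⟨ ∑ℕ-+ _ _ ⟨
  ∑ℕ (λ a → on (lookup (J ∪ K) a) (s a) ℕ.+ on (lookup (J ∩ K) a) (s a))
    ≡⟨ ∑ℕ-cong pointwise ⟩
  ∑ℕ (λ a → on (lookup J a) (s a) ℕ.+ on (lookup K a) (s a)) ≡⟨ ∑ℕ-+ _ _ ⟩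
  weight s J ℕ.+ weight s K ∎
  where
  open ≡-Reasoning
  pointwise : ∀ a → on (lookup (J ∪ K) a) (s a) ℕ.+ on (lookup (J ∩ K) a) (s a)
                  ≡ on (lookup J a) (s a) ℕ.+ on (lookup K a) (s a)
  pointwise a
    rewrite Vec.lookup-zipWith _∨_ a J K | Vec.lookup-zipWith _∧_ a J K
    with lookup J a | lookup K a
  ... | true  | true  = refl
  ... | true  | false = refl
  ... | false | true  = ℕ.+-identityʳ _
  ... | false | false = refl

weight-∅ : ∀ {n} (s : Fin n → ℕ) → weight s ∅ ≡ 0
weight-∅ {n} s = trans (∑ℕ-cong λ a → cong (λ b → on b (s a)) (∉⇒lookup (Subset.∉⊥ {x = a})))
                       (∑ℕ-zero n)

weight-⁅⁆ : ∀ {n} (s : Fin n → ℕ) i → weight s ⁅ i ⁆ ≡ s i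
weight-⁅⁆ s i = trans (∑ℕ-cong pointwise) (∑ℕ-δ i s)
  where
  pointwise : ∀ a → on (lookup ⁅ i ⁆ a) (s a) ≡ δ i a ℕ.* s a
  pointwise a with i Fin.≟ a
  ... | yes refl = trans (cong (λ b → on b (s i)) (Vec.[]=⇒lookup (Subset.x∈⁅x⁆ i))) (sym (ℕ.+-identityʳ _))
  ... | no  i≢a  = cong (λ b → on b (s a)) (∉⇒lookup (λ a∈ → i≢a (sym (Subset.x∈⁅y⁆⇒x≡y i a∈))))

weight-remove : ∀ {n} (s : Fin n → ℕ) i {s′} → (∀ a → s a ≡ s′ a ℕ.+ δ i a) →
  ∀ J → weight s J ≡ weight s′ J ℕ.+ on (lookup J i) 1
weight-remove s i {s′} eq J = begin
  weight s J ≡⟨ ∑ℕ-cong pointwise ⟩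
  ∑ℕ (λ a → on (lookup J a) (s′ a) ℕ.+ δ i a ℕ.* on (lookup J a) 1) ≡⟨ ∑ℕ-+ _ _ ⟩
  weight s′ J ℕ.+ ∑ℕ (λ a → δ i a ℕ.* on (lookup J a) 1) ≡⟨ cong (weight s′ J ℕ.+_) (∑ℕ-δ i _) ⟩
  weight s′ J ℕ.+ on (lookup J i) 1 ∎
  where
  open ≡-Reasoning
  pointwise : ∀ a → on (lookup J a) (s a) ≡ on (lookup J a) (s′ a) ℕ.+ δ i a ℕ.* on (lookup J a) 1
  pointwise a with lookup J a
  ... | true  = trans (eq a) (cong (s′ a ℕ.+_) (sym (ℕ.*-identityʳ _)))
  ... | false = sym (ℕ.*-zeroʳ (δ i a))

module Transport {p q} (R : Fin p → Fin q → Set) (R? : ∀ l r → Dec (R l r)) where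

  -- Y may be any superset of the neighbourhood of J, so that closed pairs are stable under
  -- componentwise union and intersection.
  Closed : Subset p → Subset q → Set
  Closed J Y = ∀ l r → R l r → l ∈ J → r ∈ Y

  HallCondition : (Fin p → ℕ) → (Fin q → ℕ) → Set
  HallCondition s d = ∀ J Y → Closed J Y → weight s J ℕ.≤ weight d Y

  record Plan (s : Fin p → ℕ) (d : Fin q → ℕ) : Set where
    field
      amount  : Fin p → Fin q → ℕ
      support : ∀ l r → ¬ R l r → amount l r ≡ 0
      rows    : ∀ l → ∑ℕ (amount l) ≡ s l
      columns : ∀ r → ∑ℕ (λ l → amount l r) ≡ d r

  -- Under the Hall condition `tight` is an equality. Which elements Y contains is left open, so the
  -- empty pair qualifies and can start the induction in `cover`.
  record Tight (s : Fin p → ℕ) (d : Fin q → ℕ) (l : Fin p) : Set where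
    field
      J      : Subset p
      Y      : Subset q
      closed : Closed J Y
      l∉J    : l ∉ J
      tight  : weight d Y ℕ.≤ weight s J

  -- Shipping a unit from l to r would break the Hall condition for such a pair (J , Y).
  Obstructed : (Fin p → ℕ) → (Fin q → ℕ) → Fin p → Fin q → Set
  Obstructed s d l r = ∃ λ J → ∃ λ Y → Closed J Y × l ∉ J × r ∈ Y × weight d Y ℕ.≤ weight s J

  obstructed? : ∀ s d l r → Dec (Obstructed s d l r)
  obstructed? s d l r = anySubset? λ J → anySubset? λ Y →
    Fin.all? (λ a → Fin.all? λ b → R? a b →-dec a ∈? J →-dec b ∈? Y)
    ×-dec ¬? (l ∈? J) ×-dec r ∈? Y ×-dec weight d Y ℕ.≤? weight s J

  module _ {s : Fin p → ℕ} {d : Fin q → ℕ} (hall : HallCondition s d) (l : Fin p) where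

    -- Uncrossing: by modularity, an excess of demand over supply on the union would be an excess of
    -- supply over demand on the intersection, against the Hall condition.
    merge : (A B : Tight s d l) → ∃ λ (C : Tight s d l) →
      ∀ {r} → r ∈ Tight.Y A ⊎ r ∈ Tight.Y B → r ∈ Tight.Y C
    merge A B = record
      { J = A.J ∪ B.J ; Y = A.Y ∪ B.Y
      ; closed = λ a b ab a∈ → [ (λ a∈J → Subset.x∈p∪q⁺ (inj₁ (A.closed a b ab a∈J)))
                               , (λ a∈J → Subset.x∈p∪q⁺ (inj₂ (B.closed a b ab a∈J))) ]′
                               (Subset.x∈p∪q⁻ A.J B.J a∈)
      ; l∉J = λ l∈ → [ A.l∉J , B.l∉J ]′ (Subset.x∈p∪q⁻ A.J B.J l∈)
      ; tight = ℕ.+-cancelʳ-≤ (weight d (A.Y ∩ B.Y)) _ _ (begin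
          weight d (A.Y ∪ B.Y) ℕ.+ weight d (A.Y ∩ B.Y) ≡⟨ weight-∪-∩ d A.Y B.Y ⟩
          weight d A.Y ℕ.+ weight d B.Y                 ≤⟨ ℕ.+-mono-≤ A.tight B.tight ⟩
          weight s A.J ℕ.+ weight s B.J                 ≡⟨ weight-∪-∩ s A.J B.J ⟨
          weight s (A.J ∪ B.J) ℕ.+ weight s (A.J ∩ B.J) ≤⟨ ℕ.+-monoʳ-≤ _ (hall _ _ ∩-closed) ⟩
          weight s (A.J ∪ B.J) ℕ.+ weight d (A.Y ∩ B.Y) ∎)
      } , Subset.x∈p∪q⁺
      where
      open ℕ.≤-Reasoning
      module A = Tight A
      module B = Tight B
      ∩-closed : Closed (A.J ∩ B.J) (A.Y ∩ B.Y)
      ∩-closed a b ab a∈ = Subset.x∈p∩q⁺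
        ( A.closed a b ab (proj₁ (Subset.x∈p∩q⁻ A.J B.J a∈))
        , B.closed a b ab (proj₂ (Subset.x∈p∩q⁻ A.J B.J a∈)))

    -- Merging the obstructions one by one gives a single tight pair that obstructs all arcs out of
    -- `l` at once.
    cover : (∀ r → R l r → Obstructed s d l r) → (rs : List (Fin q)) →
      ∃ λ (C : Tight s d l) → ∀ {r} → r ∈ˡ rs → R l r → r ∈ Tight.Y C
    cover obs [] = record
      { J = ∅ ; Y = ∅ ; closed = λ a b ab a∈ → contradiction a∈ Subset.∉⊥
      ; l∉J = Subset.∉⊥
      ; tight = subst (ℕ._≤ weight s ∅) (sym (weight-∅ d)) ℕ.z≤n } , λ ()
    cover obs (r ∷ rs) with cover obs rs | R? l r
    ... | C , covers | no ¬lr = C , λ { (here refl) lr → contradiction lr ¬lr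
                                      ; (there r∈) → covers r∈ }
    ... | C , covers | yes lr with obs r lr
    ...   | J , Y , closed , l∉J , r∈Y , tight
          with merge C record { J = J ; Y = Y ; closed = closed ; l∉J = l∉J ; tight = tight }
    ...     | D , includes = D , λ { (here refl) _ → includes (inj₂ r∈Y)
                                   ; (there r∈) lr → includes (inj₁ (covers r∈ lr)) }

    -- Otherwise one tight pair covers every neighbour of `l`. Adding `l` to its first set keeps it
    -- closed and adds positive supply but no demand, which violates the Hall condition.
    unobstructed : 0 ℕ.< s l → ∃ λ r → R l r × ¬ Obstructed s d l r
    unobstructed 0<sl with Fin.any? (λ r → R? l r ×-dec ¬? (obstructed? s d l r))
    ... | yes found = found
    ... | no none with cover (λ r lr → decidable-stable (obstructed? s d l r)
                                          (λ ¬obs → none (r , lr , ¬obs))) (allFin q)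
    ...   | C , covers = contradiction excess (ℕ.<⇒≱ deficit)
      where
      open Tight C
      J+l : Subset p
      J+l = J ∪ ⁅ l ⁆
      disjoint : weight s (J ∩ ⁅ l ⁆) ≡ 0
      disjoint = trans (cong (weight s) (Subset.Empty-unique empty)) (weight-∅ s)
        where
        empty : ¬ ∃ (_∈ (J ∩ ⁅ l ⁆))
        empty (a , a∈) with Subset.x∈p∩q⁻ J ⁅ l ⁆ a∈
        ... | a∈J , a∈l = l∉J (subst (_∈ J) (Subset.x∈⁅y⁆⇒x≡y l a∈l) a∈J)
      excess : weight s J+l ℕ.≤ weight d Y
      excess = hall J+l Y λ a b ab a∈ →
        [ closed a b ab
        , (λ a∈l → covers (∈-allFin b) (subst (λ c → R c b) (Subset.x∈⁅y⁆⇒x≡y l a∈l) ab)) ]′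
        (Subset.x∈p∪q⁻ J ⁅ l ⁆ a∈)
      deficit : weight d Y ℕ.< weight s J+l
      deficit = begin-strict
        weight d Y                              ≤⟨ tight ⟩
        weight s J                              <⟨ ℕ.m<m+n _ 0<sl ⟩
        weight s J ℕ.+ s l                      ≡⟨ cong (weight s J ℕ.+_) (weight-⁅⁆ s l) ⟨
        weight s J ℕ.+ weight s ⁅ l ⁆           ≡⟨ weight-∪-∩ s J ⁅ l ⁆ ⟨
        weight s J+l ℕ.+ weight s (J ∩ ⁅ l ⁆)   ≡⟨ cong (weight s J+l ℕ.+_) disjoint ⟩
        weight s J+l ℕ.+ 0                      ≡⟨ ℕ.+-identityʳ _ ⟩
        weight s J+l                            ∎
        where open ℕ.≤-Reasoning

  decrement : ∀ {n} (s : Fin n → ℕ) i → 0 ℕ.< s i → ∃ λ s′ → ∀ a → s a ≡ s′ a ℕ.+ δ i a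
  decrement s i 0<si = (λ a → s a ℕ.∸ δ i a) , λ a → sym (ℕ.m∸n+n≡m (δ≤ a))
    where
    δ≤ : ∀ a → δ i a ℕ.≤ s a
    δ≤ a with i Fin.≟ a
    ... | yes refl = 0<si
    ... | no  _    = ℕ.z≤n

  ∑ℕ-decrement : ∀ {n} {s s′ : Fin n → ℕ} {i} → (∀ a → s a ≡ s′ a ℕ.+ δ i a) →
    ∑ℕ s ≡ suc (∑ℕ s′)
  ∑ℕ-decrement {s = s} {s′} {i} eq = begin
    ∑ℕ s                      ≡⟨ ∑ℕ-cong eq ⟩
    ∑ℕ (λ a → s′ a ℕ.+ δ i a) ≡⟨ ∑ℕ-+ _ _ ⟩
    ∑ℕ s′ ℕ.+ ∑ℕ (δ i)        ≡⟨ cong (∑ℕ s′ ℕ.+_) (∑ℕ-δ-one i) ⟩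
    ∑ℕ s′ ℕ.+ 1               ≡⟨ ℕ.+-comm _ 1 ⟩
    suc (∑ℕ s′)               ∎
    where open ≡-Reasoning

  -- Induction on the total. Shipping one unit from `l` to `r` can only hurt a pair with `r` in Y
  -- and `l` outside J; as the arc is unobstructed, such a pair is not tight and has a unit to
  -- spare.
  transport-total : ∀ t {s d} → ∑ℕ s ≡ t → ∑ℕ d ≡ t → HallCondition s d → Plan s d
  transport-total zero {s} {d} ∑s ∑d hall = record
    { amount = λ _ _ → 0
    ; support = λ _ _ _ → refl
    ; rows = λ l → trans (∑ℕ-zero q)
        (sym (ℕ.n≤0⇒n≡0 (subst (s l ℕ.≤_) ∑s (entry≤∑ℕ s l))))
    ; columns = λ r → trans (∑ℕ-zero p)
        (sym (ℕ.n≤0⇒n≡0 (subst (d r ℕ.≤_) ∑d (entry≤∑ℕ d r))))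
    }
  transport-total (suc t) {s} {d} ∑s ∑d hall
    with positive-entry s (subst (0 ℕ.<_) (sym ∑s) ℕ.z<s)
  ... | l , 0<sl with unobstructed hall l 0<sl
  ... | r , lr , free with decrement s l 0<sl | decrement d r 0<dr
    where
    -- Without demand at `r` the pair of ∅ and {r} would be an obstruction.
    0<dr : 0 ℕ.< d r
    0<dr = ℕ.≰⇒> λ dr≤0 → free
      ( ∅ , ⁅ r ⁆ , (λ a b _ a∈ → contradiction a∈ Subset.∉⊥) , Subset.∉⊥ , Subset.x∈⁅x⁆ r
      , subst₂ ℕ._≤_ (sym (weight-⁅⁆ d r)) (sym (weight-∅ s)) dr≤0)
  ... | s′ , s≡ | d′ , d≡ = record
    { amount = λ a b → amount a b ℕ.+ δ l a ℕ.* δ r b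
    ; support = support′
    ; rows = λ a → begin
        ∑ℕ (λ b → amount a b ℕ.+ δ l a ℕ.* δ r b)      ≡⟨ ∑ℕ-+ _ _ ⟩
        ∑ℕ (amount a) ℕ.+ ∑ℕ (λ b → δ l a ℕ.* δ r b)   ≡⟨ cong₂ ℕ._+_ (rows a) (∑ℕ-*ˡ (δ l a) (δ r)) ⟩
        s′ a ℕ.+ δ l a ℕ.* ∑ℕ (δ r)                    ≡⟨ cong (λ c → s′ a ℕ.+ δ l a ℕ.* c) (∑ℕ-δ-one r) ⟩
        s′ a ℕ.+ δ l a ℕ.* 1                           ≡⟨ cong (s′ a ℕ.+_) (ℕ.*-identityʳ _) ⟩
        s′ a ℕ.+ δ l a                                 ≡⟨ s≡ a ⟨
        s a                                            ∎
    ; columns = λ b → begin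
        ∑ℕ (λ a → amount a b ℕ.+ δ l a ℕ.* δ r b)              ≡⟨ ∑ℕ-+ _ _ ⟩
        ∑ℕ (λ a → amount a b) ℕ.+ ∑ℕ (λ a → δ l a ℕ.* δ r b)
            ≡⟨ cong₂ ℕ._+_ (columns b) (∑ℕ-δ l (λ _ → δ r b)) ⟩
        d′ b ℕ.+ δ r b                                         ≡⟨ d≡ b ⟨
        d b                                                    ∎
    }
    where
    hall′ : HallCondition s′ d′
    hall′ J Y closed with r ∈? Y | l ∈? J
    ... | no r∉Y | _ = begin
      weight s′ J                           ≤⟨ ℕ.m≤m+n _ _ ⟩
      weight s′ J ℕ.+ on (lookup J l) 1     ≡⟨ weight-remove s l s≡ J ⟨
      weight s J                            ≤⟨ hall J Y closed ⟩
      weight d Y                            ≡⟨ weight-remove d r d≡ Y ⟩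
      weight d′ Y ℕ.+ on (lookup Y r) 1     ≡⟨ cong (λ b → weight d′ Y ℕ.+ on b 1) (∉⇒lookup r∉Y) ⟩
      weight d′ Y ℕ.+ 0                     ≡⟨ ℕ.+-identityʳ _ ⟩
      weight d′ Y                           ∎
      where open ℕ.≤-Reasoning
    ... | yes r∈Y | yes l∈J = ℕ.+-cancelʳ-≤ 1 _ _ (begin
      weight s′ J ℕ.+ 1                     ≡⟨ cong (λ b → weight s′ J ℕ.+ on b 1) (Vec.[]=⇒lookup l∈J) ⟨
      weight s′ J ℕ.+ on (lookup J l) 1     ≡⟨ weight-remove s l s≡ J ⟨
      weight s J                            ≤⟨ hall J Y closed ⟩
      weight d Y                            ≡⟨ weight-remove d r d≡ Y ⟩
      weight d′ Y ℕ.+ on (lookup Y r) 1     ≡⟨ cong (λ b → weight d′ Y ℕ.+ on b 1) (Vec.[]=⇒lookup r∈Y) ⟩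
      weight d′ Y ℕ.+ 1                     ∎)
      where open ℕ.≤-Reasoning
    ... | yes r∈Y | no l∉J = ℕ.+-cancelʳ-≤ 1 _ _ (begin
      weight s′ J ℕ.+ 1                     ≤⟨ ℕ.+-monoˡ-≤ 1 (ℕ.m≤m+n _ _) ⟩
      (weight s′ J ℕ.+ on (lookup J l) 1) ℕ.+ 1 ≡⟨ cong (ℕ._+ 1) (weight-remove s l s≡ J) ⟨
      weight s J ℕ.+ 1                      ≡⟨ ℕ.+-comm _ 1 ⟩
      suc (weight s J)                      ≤⟨ ℕ.≰⇒> (λ tight → free (J , Y , closed , l∉J , r∈Y , tight)) ⟩
      weight d Y                            ≡⟨ weight-remove d r d≡ Y ⟩
      weight d′ Y ℕ.+ on (lookup Y r) 1     ≡⟨ cong (λ b → weight d′ Y ℕ.+ on b 1) (Vec.[]=⇒lookup r∈Y) ⟩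
      weight d′ Y ℕ.+ 1                     ∎)
      where open ℕ.≤-Reasoning
    open Plan (transport-total t {s′} {d′}
      (ℕ.suc-injective (trans (sym (∑ℕ-decrement {i = l} s≡)) ∑s))
      (ℕ.suc-injective (trans (sym (∑ℕ-decrement {i = r} d≡)) ∑d)) hall′)
    open ≡-Reasoning
    support′ : ∀ a b → ¬ R a b → amount a b ℕ.+ δ l a ℕ.* δ r b ≡ 0
    support′ a b ¬ab rewrite support a b ¬ab with l Fin.≟ a | r Fin.≟ b
    ... | yes refl | yes refl = contradiction lr ¬ab
    ... | yes _    | no  _    = refl
    ... | no  _    | _        = refl

  transport : ∀ {s d} → ∑ℕ s ≡ ∑ℕ d → HallCondition s d → Plan s d
  transport eq = transport-total _ eq refl

-- Unit flows from Menger's theorem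

opaque
  unfolding ∑ℕ

  card≡weight : ∀ {n} (S : Subset n) → card S ≡ weight (λ _ → 1) S
  card≡weight []          = refl
  card≡weight (true  ∷ S) = cong suc (card≡weight S)
  card≡weight (false ∷ S) = card≡weight S

edge : (G : Graph) → Fin (order G) → Fin (order G) → ℕ
edge G a b = on (Graph.adj G a b) 1

degree≡∑ : ∀ G a → Graph.degree G a ≡ ∑ℕ (edge G a)
degree≡∑ G a = trans (card≡weight (Graph.neighbours G a))
  (∑ℕ-cong λ b → cong (λ c → on c 1) (Vec.lookup∘tabulate (Graph.adj G a) b))

edge-yes : ∀ G {a b} → Graph.Adjacent G a b → edge G a b ≡ 1
edge-yes G {a} {b} ab with Graph.adj G a b
... | true = refl

edge-no : ∀ G {a b} → ¬ Graph.Adjacent G a b → edge G a b ≡ 0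
edge-no G {a} {b} ¬ab with Graph.adj G a b
... | true  = contradiction tt ¬ab
... | false = refl

-- Both laws are stated additively to stay in ℕ: k units appear at `u` and disappear at `i`, and
-- `total` says that the number of edges used is at most n - deg u + 2k - 2. Cycles, and flow in
-- both directions of an edge, are allowed.
record UnitFlow (G : Graph) (k : ℕ) (u i : Fin (order G)) : Set where
  field
    flow         : Fin (order G) → Fin (order G) → ℕ
    unit         : ∀ a b → flow a b ≡ 0 ⊎ flow a b ≡ 1 × Graph.Adjacent G a b
    conservation : ∀ b → ∑ℕ (λ a → flow a b) ℕ.+ k ℕ.* δ u b ≡ ∑ℕ (flow b) ℕ.+ k ℕ.* δ i b
    total        : ∑ℕ (λ b → ∑ℕ (λ a → flow a b)) ℕ.+ Graph.degree G u ℕ.+ 2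
                   ℕ.≤ order G ℕ.+ 2 ℕ.* k

module Menger (G : Graph) (k : ℕ) (connected : Connected[ k ] G) (u i : Fin (order G))
              (u≢i : u ≢ i) (u≁i : ¬ Graph.Adjacent G u i) where
  open Graph G hiding (order)

  -- The single unit at both copies of any other vertex is its capacity. Zero demand at `u` and zero
  -- supply at `i` keep flow from entering the source or leaving the sink.
  supply demand : Vertex → ℕ
  supply a = if does (u Fin.≟ a) then k else if does (i Fin.≟ a) then 0 else 1
  demand b = if does (i Fin.≟ b) then k else if does (u Fin.≟ b) then 0 else 1

  balance : ∀ a → demand a ℕ.+ k ℕ.* δ u a ≡ supply a ℕ.+ k ℕ.* δ i a
  balance a with u Fin.≟ a | i Fin.≟ a
  ... | yes refl | yes refl = contradiction refl u≢i
  ... | yes _    | no  _    = trans (ℕ.*-identityʳ k) (sym (trans (cong (k ℕ.+_) (ℕ.*-zeroʳ k))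
      (ℕ.+-identityʳ k)))
  ... | no  _    | yes _    = trans (trans (cong (k ℕ.+_) (ℕ.*-zeroʳ k)) (ℕ.+-identityʳ k)) (sym
      (ℕ.*-identityʳ k))
  ... | no  _    | no  _    = refl

  ∑-kδ : ∀ (f : Vertex → ℕ) v → ∑ℕ (λ a → f a ℕ.+ k ℕ.* δ v a) ≡ ∑ℕ f ℕ.+ k
  ∑-kδ f v = trans (∑ℕ-+ _ _)
    (cong (∑ℕ f ℕ.+_) (trans (∑ℕ-*ˡ k (δ v)) (trans (cong (k ℕ.*_) (∑ℕ-δ-one v)) (ℕ.*-identityʳ k))))

  ∑supply≡∑demand : ∑ℕ supply ≡ ∑ℕ demand
  ∑supply≡∑demand = ℕ.+-cancelʳ-≡ k _ _
    (trans (sym (∑-kδ supply i)) (trans (∑ℕ-cong (λ a → sym (balance a))) (∑-kδ demand u)))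

  -- A neighbour of u may only be entered from u, so at most k neighbours of u carry flow.
  Link : Vertex → Vertex → Set
  Link a b = a ≡ b ⊎ Adjacent a b × (a ≡ u ⊎ ¬ Adjacent u b)

  link? : ∀ a b → Dec (Link a b)
  link? a b = a Fin.≟ b ⊎-dec T? (adj a b) ×-dec (a Fin.≟ u ⊎-dec ¬? (T? (adj u b)))

  open Transport Link link?

  module _ (J Y : Subset (order G)) (closed : Closed J Y) where

    J⊆Y : ∀ {a} → a ∈ J → a ∈ Y
    J⊆Y {a} = closed a a (inj₁ refl)

    J≤Y : ∀ a m → on (lookup J a) m ℕ.≤ on (lookup Y a) m
    J≤Y a m with a ∈? J
    ... | yes a∈J rewrite Vec.[]=⇒lookup a∈J | Vec.[]=⇒lookup (J⊆Y a∈J) = ℕ.≤-refl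
    ... | no  a∉J rewrite ∉⇒lookup a∉J = ℕ.z≤n

    on-0 : ∀ b → on b 0 ≡ 0
    on-0 true  = refl
    on-0 false = refl

    on≤ : ∀ b m → on b m ℕ.≤ m
    on≤ true  m = ℕ.≤-refl
    on≤ false m = ℕ.z≤n

    -- Away from `u` supply never exceeds demand, so J ⊆ Y suffices.
    source-outside : u ∉ J → weight supply J ℕ.≤ weight demand Y
    source-outside u∉J = ∑ℕ-mono pointwise
      where
      pointwise : ∀ a → on (lookup J a) (supply a) ℕ.≤ on (lookup Y a) (demand a)
      pointwise a with u Fin.≟ a | i Fin.≟ a
      ... | yes refl | _     rewrite ∉⇒lookup u∉J = ℕ.z≤n
      ... | no _     | yes _ rewrite on-0 (lookup J a) = ℕ.z≤n
      ... | no _     | no  _ = J≤Y a 1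

    -- The demand k at `i` pays for the supply k at `u`; elsewhere J ⊆ Y suffices.
    sink-inside : i ∈ Y → weight supply J ℕ.≤ weight demand Y
    sink-inside i∈Y = ℕ.+-cancelʳ-≤ k _ _
      (subst₂ ℕ._≤_ (∑-kδ _ i) (∑-kδ _ u) (∑ℕ-mono pointwise))
      where
      pointwise : ∀ a → on (lookup J a) (supply a) ℕ.+ k ℕ.* δ i a
                    ℕ.≤ on (lookup Y a) (demand a) ℕ.+ k ℕ.* δ u a
      pointwise a with u Fin.≟ a | i Fin.≟ a
      ... | yes refl | yes refl = contradiction refl u≢i
      ... | yes refl | no _ rewrite ℕ.*-zeroʳ k | ℕ.*-identityʳ k | on-0 (lookup Y a) | ℕ.+-identityʳ (on
          (lookup J a) k) = on≤ (lookup J a) k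
      ... | no _ | yes refl rewrite on-0 (lookup J a) | Vec.[]=⇒lookup i∈Y | ℕ.*-identityʳ k = ℕ.m≤m+n k _
      ... | no _ | no _ = ℕ.+-monoˡ-≤ _ (J≤Y a 1)

    -- A path from u that avoids Y ∖ J never leaves J.
    separator : Subset (order G)
    separator = Y ∩ ∁ J

    separator⊆Y : ∀ {a} → a ∈ separator → a ∈ Y
    separator⊆Y = proj₁ ∘ Subset.x∈p∩q⁻ Y (∁ J)

    separator⊥J : ∀ {a} → a ∈ separator → a ∉ J
    separator⊥J = Subset.x∈∁p⇒x∉p ∘ proj₂ ∘ Subset.x∈p∩q⁻ Y (∁ J)

    separator-large : u ∈ J → i ∉ Y → k ℕ.≤ card separator
    separator-large u∈J i∉Y = ℕ.≮⇒≥ λ small →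
      i∉Y (J⊆Y (reach (proj₂ connected separator small u i
        (λ u∈S → separator⊥J u∈S u∈J) (i∉Y ∘ separator⊆Y)) u∈J))
      where
      reach : ∀ {a b} → Star (AdjacentOutside G separator) a b → a ∈ J → b ∈ J
      reach stop a∈J = a∈J
      reach (_◅_ {j = b} (_ , b∉S , ab) path) a∈J = reach path
        (decidable-stable (b ∈? J) λ b∉J → b∉S (Subset.x∈p∩q⁺ (b∈Y , Subset.x∉p⇒x∈∁p b∉J)))
        where
        b∈Y : b ∈ Y
        -- `Link` may forbid entering a neighbour of `u` from the current vertex, but `u` itself is
        -- linked to it and lies in J.
        b∈Y with T? (adj u b)
        ... | yes ub = closed u b (inj₂ (ub , inj₁ refl)) u∈J
        ... | no ¬ub = closed _ b (inj₂ (ab , inj₂ ¬ub)) a∈J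

    -- Since `u` lies in both sets and `i` in neither, the supply of J is |J| - 1 + k and the demand
    -- of Y is |Y| - 1. The Hall inequality thus says exactly that `separator` has at least k
    -- elements.
    separating : u ∈ J → i ∉ Y → weight supply J ℕ.≤ weight demand Y
    separating u∈J i∉Y = ℕ.+-cancelʳ-≤ k _ _ (begin
      weight supply J ℕ.+ k                            ≤⟨ ℕ.+-monoʳ-≤ _ (separator-large u∈J i∉Y) ⟩
      weight supply J ℕ.+ card separator                ≡⟨ cong (weight supply J ℕ.+_) (card≡weight separator) ⟩
      weight supply J ℕ.+ weight (λ _ → 1) separator   ≡⟨ ∑ℕ-+ _ _ ⟨
      ∑ℕ (λ a → on (lookup J a) (supply a) ℕ.+ on (lookup separator a) 1) ≤⟨ ∑ℕ-mono pointwise ⟩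
      ∑ℕ (λ a → on (lookup Y a) (demand a) ℕ.+ k ℕ.* δ u a) ≡⟨ ∑-kδ _ u ⟩
      weight demand Y ℕ.+ k ∎)
      where
      open ℕ.≤-Reasoning
      inside : ∀ a → a ∈ J → lookup separator a ≡ false
      inside a a∈J = ∉⇒lookup {J = separator} λ a∈S → separator⊥J a∈S a∈J
      outside : ∀ a → a ∉ Y → lookup separator a ≡ false
      outside a a∉Y = ∉⇒lookup {J = separator} (a∉Y ∘ separator⊆Y)
      pointwise : ∀ a → on (lookup J a) (supply a) ℕ.+ on (lookup separator a) 1
                    ℕ.≤ on (lookup Y a) (demand a) ℕ.+ k ℕ.* δ u a
      pointwise a with u Fin.≟ a | i Fin.≟ a
      ... | yes refl | _ rewrite Vec.[]=⇒lookup u∈J | inside a u∈J | ℕ.+-identityʳ k | ℕ.*-identityʳ k =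
          ℕ.m≤n+m k _
      ... | no _ | yes refl rewrite on-0 (lookup J a) | outside a i∉Y = ℕ.z≤n
      ... | no _ | no _ rewrite ℕ.*-zeroʳ k with a ∈? J | a ∈? Y
      ...   | yes a∈J | _ rewrite Vec.[]=⇒lookup a∈J | inside a a∈J | Vec.[]=⇒lookup (J⊆Y a∈J) = ℕ.≤-refl
      ...   | no a∉J | yes a∈Y rewrite ∉⇒lookup a∉J | Vec.[]=⇒lookup a∈Y = ℕ.≤-trans (on≤
          (lookup separator a) 1) (ℕ.m≤m+n 1 _)
      ...   | no a∉J | no a∉Y rewrite ∉⇒lookup a∉J | outside a a∉Y = ℕ.z≤n

    hall-pair : weight supply J ℕ.≤ weight demand Y
    hall-pair with u ∈? J | i ∈? Y
    ... | no u∉J  | _       = source-outside u∉J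
    ... | yes _   | yes i∈Y = sink-inside i∈Y
    ... | yes u∈J | no i∉Y  = separating u∈J i∉Y

  open Plan (transport ∑supply≡∑demand hall-pair)

  offDiagonal : Vertex → Vertex → ℕ
  offDiagonal a b = if does (a Fin.≟ b) then 0 else amount a b

  split-diagonal : ∀ a b → amount a b ≡ offDiagonal a b ℕ.+ δ a b ℕ.* amount a b
  split-diagonal a b with a Fin.≟ b
  ... | yes _ = sym (ℕ.+-identityʳ _)
  ... | no  _ = sym (ℕ.+-identityʳ _)

  δ-sym : ∀ (a b : Vertex) → δ a b ≡ δ b a
  δ-sym a b with a Fin.≟ b
  ... | yes refl = sym (δ-refl a)
  ... | no  a≢b  = sym (δ-≢ (a≢b ∘ sym))

  row-split : ∀ a → ∑ℕ (offDiagonal a) ℕ.+ amount a a ≡ supply a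
  row-split a = begin
    ∑ℕ (offDiagonal a) ℕ.+ amount a a ≡⟨ cong (∑ℕ (offDiagonal a) ℕ.+_) (∑ℕ-δ a (amount a)) ⟨
    ∑ℕ (offDiagonal a) ℕ.+ ∑ℕ (λ b → δ a b ℕ.* amount a b) ≡⟨ ∑ℕ-+ _ _ ⟨
    ∑ℕ (λ b → offDiagonal a b ℕ.+ δ a b ℕ.* amount a b) ≡⟨ ∑ℕ-cong (split-diagonal a) ⟨
    ∑ℕ (amount a) ≡⟨ rows a ⟩
    supply a ∎
    where open ≡-Reasoning

  column-split : ∀ b → ∑ℕ (λ a → offDiagonal a b) ℕ.+ amount b b ≡ demand b
  column-split b = begin
    ∑ℕ (λ a → offDiagonal a b) ℕ.+ amount b b
      ≡⟨ cong (∑ℕ (λ a → offDiagonal a b) ℕ.+_) (∑ℕ-δ b (λ a → amount a b)) ⟨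
    ∑ℕ (λ a → offDiagonal a b) ℕ.+ ∑ℕ (λ a → δ b a ℕ.* amount a b) ≡⟨ ∑ℕ-+ _ _ ⟨
    ∑ℕ (λ a → offDiagonal a b ℕ.+ δ b a ℕ.* amount a b)
      ≡⟨ ∑ℕ-cong (λ a → trans (split-diagonal a b) (cong (λ c → offDiagonal a b ℕ.+ c ℕ.* amount a b)
          (δ-sym a b))) ⟨
    ∑ℕ (λ a → amount a b) ≡⟨ columns b ⟩
    demand b ∎
    where open ≡-Reasoning

  column≤ : ∀ b → ∑ℕ (λ a → offDiagonal a b) ℕ.≤ demand b
  column≤ b = subst (∑ℕ (λ a → offDiagonal a b) ℕ.≤_) (column-split b) (ℕ.m≤m+n _ _)

  conservation : ∀ b → ∑ℕ (λ a → offDiagonal a b) ℕ.+ k ℕ.* δ u b ≡ ∑ℕ (offDiagonal b) ℕ.+ k ℕ.* δ i b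
  conservation b = ℕ.+-cancelʳ-≡ (amount b b) _ _ (begin
    (inflow ℕ.+ k ℕ.* δ u b) ℕ.+ amount b b  ≡⟨ swapʳ inflow (k ℕ.* δ u b) (amount b b) ⟩
    (inflow ℕ.+ amount b b) ℕ.+ k ℕ.* δ u b  ≡⟨ cong (ℕ._+ k ℕ.* δ u b) (column-split b) ⟩
    demand b ℕ.+ k ℕ.* δ u b                 ≡⟨ balance b ⟩
    supply b ℕ.+ k ℕ.* δ i b                 ≡⟨ cong (ℕ._+ k ℕ.* δ i b) (row-split b) ⟨
    (outflow ℕ.+ amount b b) ℕ.+ k ℕ.* δ i b ≡⟨ swapʳ outflow (amount b b) (k ℕ.* δ i b) ⟩
    (outflow ℕ.+ k ℕ.* δ i b) ℕ.+ amount b b ∎)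
    where
    open ≡-Reasoning
    inflow outflow : ℕ
    inflow  = ∑ℕ (λ a → offDiagonal a b)
    outflow = ∑ℕ (offDiagonal b)
    swapʳ : ∀ x y z → (x ℕ.+ y) ℕ.+ z ≡ (x ℕ.+ z) ℕ.+ y
    swapʳ x y z = trans (ℕ.+-assoc x y z) (trans (cong (x ℕ.+_) (ℕ.+-comm y z)) (sym (ℕ.+-assoc x z y)))

  supply≤1 : ∀ a → u ≢ a → supply a ℕ.≤ 1
  supply≤1 a u≢a with u Fin.≟ a | i Fin.≟ a
  ... | yes u≡a | _     = contradiction u≡a u≢a
  ... | no  _   | yes _ = ℕ.z≤n
  ... | no  _   | no  _ = ℕ.≤-refl

  demand≤1 : ∀ b → i ≢ b → demand b ℕ.≤ 1
  demand≤1 b i≢b with u Fin.≟ b | i Fin.≟ b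
  ... | _     | yes i≡b = contradiction i≡b i≢b
  ... | yes _ | no  _   = ℕ.z≤n
  ... | no  _ | no  _   = ℕ.≤-refl

  supply-u : supply u ≡ k
  supply-u with u Fin.≟ u
  ... | yes _   = refl
  ... | no  u≢u = contradiction refl u≢u

  ≤1⇒ : ∀ {m} → m ℕ.≤ 1 → m ≡ 0 ⊎ m ≡ 1
  ≤1⇒ {zero}        _ = inj₁ refl
  ≤1⇒ {suc zero}    _ = inj₂ refl
  ≤1⇒ {suc (suc m)} (ℕ.s≤s ())

  unit : ∀ a b → offDiagonal a b ≡ 0 ⊎ offDiagonal a b ≡ 1 × Adjacent a b
  unit a b with a Fin.≟ b
  ... | yes _   = inj₁ refl
  ... | no  a≢b with link? a b
  ...   | no ¬ab = inj₁ (support a b ¬ab)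
  ...   | yes (inj₁ a≡b) = contradiction a≡b a≢b
  ...   | yes (inj₂ (ab , _)) = [ inj₁ , (λ eq → inj₂ (eq , ab)) ]′ (≤1⇒ amount≤1)
    where
    amount≤1 : amount a b ℕ.≤ 1
    -- The supply of `a` bounds the amount unless `a` is `u`. In that case `b` is not `i`, because
    -- `u` and `i` are not adjacent, and the demand of `b` is the bound.
    amount≤1 with u Fin.≟ a
    ... | no u≢a = ℕ.≤-trans (entry≤∑ℕ (amount a) b)
                     (subst (ℕ._≤ 1) (sym (rows a)) (supply≤1 a u≢a))
    ... | yes refl = ℕ.≤-trans (entry≤∑ℕ (λ c → amount c b) a)
                     (subst (ℕ._≤ 1) (sym (columns b)) (demand≤1 b λ { refl → u≁i ab }))

  -- Off the diagonal, `Link` lets only `u` ship into a neighbour of `u`.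
  from-source : ∀ b → Adjacent u b → ∑ℕ (λ a → offDiagonal a b) ℕ.≤ amount u b
  from-source b ub = subst (∑ℕ (λ a → offDiagonal a b) ℕ.≤_) (∑ℕ-δ u (λ a → amount a b)) (∑ℕ-mono pointwise)
    where
    pointwise : ∀ a → offDiagonal a b ℕ.≤ δ u a ℕ.* amount a b
    pointwise a with u Fin.≟ a | a Fin.≟ b
    ... | _ | yes _ = ℕ.z≤n
    ... | yes refl | no _ = ℕ.m≤m+n _ 0
    ... | no u≢a | no a≢b = ℕ.≤-reflexive (support a b
        [ a≢b , (λ { (_ , inj₁ a≡u) → u≢a (sym a≡u) ; (_ , inj₂ ¬ub) → ¬ub ub }) ]′)

  -- Flow edges are charged to their heads: inflow is zero at `u`, at most `amount u b` at a
  -- neighbour of `u`, at most k at `i` and at most 1 elsewhere. The indicators are placed so that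
  -- the sum over `b` is `total`: the left gives the size, deg u, 1 and 1, the right gives k, n and
  -- k.
  column-bound : ∀ b → ((∑ℕ (λ a → offDiagonal a b) ℕ.+ edge G u b) ℕ.+ δ u b) ℕ.+ δ i b
                       ℕ.≤ (amount u b ℕ.+ 1) ℕ.+ k ℕ.* δ i b
  column-bound b with u Fin.≟ b | i Fin.≟ b | column≤ b
  ... | yes refl | yes refl | _   = contradiction refl u≢i
  ... | yes refl | no _     | col = begin
        ((_ ℕ.+ edge G b b) ℕ.+ 1) ℕ.+ 0
          ≡⟨ cong₂ (λ c e → ((c ℕ.+ e) ℕ.+ 1) ℕ.+ 0) (ℕ.n≤0⇒n≡0 col) (edge-no G (irreflexive {b})) ⟩
        1                                ≤⟨ ℕ.m≤n+m 1 (amount b b) ⟩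
        amount b b ℕ.+ 1                 ≤⟨ ℕ.m≤m+n _ _ ⟩
        (amount b b ℕ.+ 1) ℕ.+ k ℕ.* 0   ∎
        where open ℕ.≤-Reasoning
  ... | no _     | yes refl | col = begin
        ((c ℕ.+ edge G u b) ℕ.+ 0) ℕ.+ 1 ≡⟨ cong (λ e → ((c ℕ.+ e) ℕ.+ 0) ℕ.+ 1) (edge-no G u≁i) ⟩
        ((c ℕ.+ 0) ℕ.+ 0) ℕ.+ 1          ≡⟨ cong (ℕ._+ 1) (trans (ℕ.+-identityʳ _) (ℕ.+-identityʳ _)) ⟩
        c ℕ.+ 1                          ≤⟨ ℕ.+-monoˡ-≤ 1 col ⟩
        k ℕ.+ 1                          ≡⟨ ℕ.+-comm k 1 ⟩
        1 ℕ.+ k                          ≤⟨ ℕ.+-monoˡ-≤ k (ℕ.m≤n+m 1 (amount u b)) ⟩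
        (amount u b ℕ.+ 1) ℕ.+ k         ≡⟨ cong ((amount u b ℕ.+ 1) ℕ.+_) (ℕ.*-identityʳ k) ⟨
        (amount u b ℕ.+ 1) ℕ.+ k ℕ.* 1   ∎
        where
        open ℕ.≤-Reasoning
        c : ℕ
        c = ∑ℕ (λ a → offDiagonal a b)
  ... | no _     | no _     | col = begin
        ((c ℕ.+ edge G u b) ℕ.+ 0) ℕ.+ 0 ≡⟨ trans (ℕ.+-identityʳ _) (ℕ.+-identityʳ _) ⟩
        c ℕ.+ edge G u b                 ≤⟨ bound′ (T? (adj u b)) ⟩
        amount u b ℕ.+ 1                 ≤⟨ ℕ.m≤m+n _ _ ⟩
        (amount u b ℕ.+ 1) ℕ.+ k ℕ.* 0   ∎
        where
        open ℕ.≤-Reasoning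
        c : ℕ
        c = ∑ℕ (λ a → offDiagonal a b)
        bound′ : Dec (Adjacent u b) → c ℕ.+ edge G u b ℕ.≤ amount u b ℕ.+ 1
        bound′ (yes ub) = subst (λ e → c ℕ.+ e ℕ.≤ amount u b ℕ.+ 1) (sym (edge-yes G ub))
                            (ℕ.+-monoˡ-≤ 1 (from-source b ub))
        bound′ (no ¬ub) = subst (λ e → c ℕ.+ e ℕ.≤ amount u b ℕ.+ 1) (sym (edge-no G ¬ub))
                            (subst (ℕ._≤ amount u b ℕ.+ 1) (sym (ℕ.+-identityʳ c))
                              (ℕ.≤-trans col (ℕ.m≤n+m 1 (amount u b))))

  total : ∑ℕ (λ b → ∑ℕ (λ a → offDiagonal a b)) ℕ.+ degree u ℕ.+ 2 ℕ.≤ order G ℕ.+ 2 ℕ.* k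
  total = begin
    t ℕ.+ degree u ℕ.+ 2 ≡⟨ cong (λ c → t ℕ.+ c ℕ.+ 2) (degree≡∑ G u) ⟩
    t ℕ.+ e ℕ.+ 2        ≡⟨ ℕ.+-assoc (t ℕ.+ e) 1 1 ⟨
    (t ℕ.+ e ℕ.+ 1) ℕ.+ 1 ≡⟨ cong₂ (λ c d → (t ℕ.+ e ℕ.+ c) ℕ.+ d) (∑ℕ-δ-one u) (∑ℕ-δ-one i) ⟨
    ((t ℕ.+ e) ℕ.+ ∑ℕ (δ u)) ℕ.+ ∑ℕ (δ i) ≡⟨ cong (ℕ._+ ∑ℕ (δ i)) (trans (∑ℕ-+ _ _) (cong (ℕ._+ ∑ℕ (δ u))
        (∑ℕ-+ _ _))) ⟨
    ∑ℕ (λ b → (c b ℕ.+ edge G u b) ℕ.+ δ u b) ℕ.+ ∑ℕ (δ i) ≡⟨ ∑ℕ-+ _ _ ⟨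
    ∑ℕ (λ b → ((c b ℕ.+ edge G u b) ℕ.+ δ u b) ℕ.+ δ i b) ≤⟨ ∑ℕ-mono column-bound ⟩
    ∑ℕ (λ b → (amount u b ℕ.+ 1) ℕ.+ k ℕ.* δ i b) ≡⟨ ∑-kδ _ i ⟩
    ∑ℕ (λ b → amount u b ℕ.+ 1) ℕ.+ k     ≡⟨ cong (ℕ._+ k) (∑ℕ-+ _ _) ⟩
    (∑ℕ (amount u) ℕ.+ ∑ℕ {order G} (λ _ → 1)) ℕ.+ k
      ≡⟨ cong₂ (λ c d → (c ℕ.+ d) ℕ.+ k) (trans (rows u) supply-u) (∑ℕ-one (order G)) ⟩
    (k ℕ.+ order G) ℕ.+ k                 ≡⟨ regroup k (order G) ⟩
    order G ℕ.+ 2 ℕ.* k                   ∎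
    where
    open ℕ.≤-Reasoning
    c : Vertex → ℕ
    c b = ∑ℕ (λ a → offDiagonal a b)
    t e : ℕ
    t = ∑ℕ c
    e = ∑ℕ (edge G u)
    regroup : ∀ k n → (k ℕ.+ n) ℕ.+ k ≡ n ℕ.+ 2 ℕ.* k
    regroup = solve 2 (λ k n → (k :+ n) :+ k := n :+ con 2 :* k) refl
      where open ℕ-Solver

  unitFlow : UnitFlow G k u i
  unitFlow = record { flow = offDiagonal ; unit = unit ; conservation = conservation ; total = total }

-- Rational sums

2ℚ 3ℚ 4ℚ 8ℚ 12ℚ ⅓ ¼ : ℚ
2ℚ = ℤ.+ 2 / 1
3ℚ = ℤ.+ 3 / 1
4ℚ = ℤ.+ 4 / 1
8ℚ = ℤ.+ 8 / 1
12ℚ = ℤ.+ 12 / 1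
⅓ = ℤ.+ 1 / 3
¼ = ℤ.+ 1 / 4

0≤2ℚ : 0ℚ ≤ 2ℚ
0≤2ℚ = ℚ.nonNegative⁻¹ 2ℚ

0≤3ℚ : 0ℚ ≤ 3ℚ
0≤3ℚ = ℚ.nonNegative⁻¹ 3ℚ

0≤4ℚ : 0ℚ ≤ 4ℚ
0≤4ℚ = ℚ.nonNegative⁻¹ 4ℚ

0≤* : ∀ {p q} → 0ℚ ≤ p → 0ℚ ≤ q → 0ℚ ≤ p * q
0≤* {p} {q} 0≤p 0≤q = subst (_≤ p * q) (ℚ.*-zeroʳ p) (ℚ.*-monoˡ-≤-nonNeg p {{nonNegative 0≤p}} 0≤q)

0≤+ : ∀ {p q} → 0ℚ ≤ p → 0ℚ ≤ q → 0ℚ ≤ p + q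
0≤+ {p} {q} 0≤p 0≤q = ℚ.+-mono-≤ 0≤p 0≤q

0≤p² : ∀ p → 0ℚ ≤ p * p
0≤p² p with ℚ.≤-total 0ℚ p
... | inj₁ 0≤p = 0≤* 0≤p 0≤p
... | inj₂ p≤0 = subst (_≤ p * p) (ℚ.*-zeroʳ p) (ℚ.*-monoˡ-≤-nonPos p {{nonPositive p≤0}} p≤0)

≤-by : ∀ {p q} d → 0ℚ ≤ d → q ≡ p + d → p ≤ q
≤-by {p} {q} d 0≤d eq = subst₂ _≤_ (ℚ.+-identityʳ p) (sym eq) (ℚ.+-monoʳ-≤ p 0≤d)

≤⇒0≤- : ∀ {p q} → p ≤ q → 0ℚ ≤ q - p
≤⇒0≤- {p} {q} p≤q = subst (_≤ q - p) (ℚ.+-inverseʳ p) (ℚ.+-monoˡ-≤ (- p) p≤q)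

opaque
  ι : ℕ → ℚ
  ι n = ℤ.+ n / 1

  ιᵘ : ∀ n → toℚᵘ (ι n) ℚᵘ.≃ ℚᵘ.mkℚᵘ (ℤ.+ n) 0
  ιᵘ n = ℚ.toℚᵘ-fromℚᵘ (ℚᵘ.mkℚᵘ (ℤ.+ n) 0)

  ι-+ : ∀ m n → ι (m ℕ.+ n) ≡ ι m + ι n
  ι-+ m n = ℚ.toℚᵘ-injective (begin
    toℚᵘ (ι (m ℕ.+ n))                          ≈⟨ ιᵘ (m ℕ.+ n) ⟩
    ℚᵘ.mkℚᵘ (ℤ.+ (m ℕ.+ n)) 0                     ≈⟨ ℚᵘ.*≡* (cong (ℤ._* (ℤ.+ 1)) (sym (cong₂ ℤ._+_
        (ℤ.*-identityʳ (ℤ.+ m)) (ℤ.*-identityʳ (ℤ.+ n))))) ⟩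
    ℚᵘ.mkℚᵘ (ℤ.+ m) 0 ℚᵘ.+ ℚᵘ.mkℚᵘ (ℤ.+ n) 0        ≈⟨ ℚᵘ.+-cong (ιᵘ m) (ιᵘ n) ⟨
    toℚᵘ (ι m) ℚᵘ.+ toℚᵘ (ι n)                  ≈⟨ ℚ.toℚᵘ-homo-+ (ι m) (ι n) ⟨
    toℚᵘ (ι m + ι n)                            ∎)
    where open ℚᵘ.≃-Reasoning

  ι-* : ∀ m n → ι (m ℕ.* n) ≡ ι m * ι n
  ι-* m n = ℚ.toℚᵘ-injective (begin
    toℚᵘ (ι (m ℕ.* n))                          ≈⟨ ιᵘ (m ℕ.* n) ⟩
    ℚᵘ.mkℚᵘ (ℤ.+ (m ℕ.* n)) 0                     ≈⟨ ℚᵘ.*≡* (cong (ℤ._* (ℤ.+ 1)) (ℤ.pos-* m n)) ⟩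
    ℚᵘ.mkℚᵘ (ℤ.+ m) 0 ℚᵘ.* ℚᵘ.mkℚᵘ (ℤ.+ n) 0        ≈⟨ ℚᵘ.*-cong (ιᵘ m) (ιᵘ n) ⟨
    toℚᵘ (ι m) ℚᵘ.* toℚᵘ (ι n)                  ≈⟨ ℚ.toℚᵘ-homo-* (ι m) (ι n) ⟨
    toℚᵘ (ι m * ι n)                            ∎)
    where open ℚᵘ.≃-Reasoning

  0≤ι : ∀ n → 0ℚ ≤ ι n
  0≤ι n = ℚ.nonNegative⁻¹ (ι n) {{ℚ.normalize-nonNeg n 1}}

  ι-0 : ι 0 ≡ 0ℚ
  ι-0 = refl

  ι-1 : ι 1 ≡ 1ℚ
  ι-1 = refl

  ι-2 : ι 2 ≡ 2ℚ
  ι-2 = refl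

ι-mono : ∀ {m n} → m ℕ.≤ n → ι m ≤ ι n
ι-mono {m} {n} m≤n = ≤-by (ι (n ℕ.∸ m)) (0≤ι _)
  (trans (cong ι (sym (ℕ.m+[n∸m]≡n m≤n))) (ι-+ m (n ℕ.∸ m)))

opaque
  ∑ : ∀ {n} → (Fin n → ℚ) → ℚ
  ∑ = ΣQ.sum

  ∑-cong : ∀ {n} {f g : Fin n → ℚ} → (∀ i → f i ≡ g i) → ∑ f ≡ ∑ g
  ∑-cong = ΣQ.sum-cong-≗

  ∑-+ : ∀ {n} (f g : Fin n → ℚ) → ∑ (λ i → f i + g i) ≡ ∑ f + ∑ g
  ∑-+ = ΣQ.∑-distrib-+

  ∑-*ˡ : ∀ {n} c (f : Fin n → ℚ) → ∑ (λ i → c * f i) ≡ c * ∑ f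
  ∑-*ˡ c f = sym (ΣQ.*-distribˡ-sum c f)

  ∑-comm : ∀ {m n} (f : Fin m → Fin n → ℚ) →
    ∑ (λ i → ∑ (f i)) ≡ ∑ (λ j → ∑ (λ i → f i j))
  ∑-comm = ΣQ.∑-comm

  ∑-zero : ∀ n → ∑ {n} (λ _ → 0ℚ) ≡ 0ℚ
  ∑-zero = ΣQ.sum-replicate-zero

  ∑-mono : ∀ {n} {f g : Fin n → ℚ} → (∀ i → f i ≤ g i) → ∑ f ≤ ∑ g
  ∑-mono {zero}  f≤g = ℚ.≤-refl
  ∑-mono {suc n} f≤g = ℚ.+-mono-≤ (f≤g zero) (∑-mono (λ i → f≤g (suc i)))

opaque
  unfolding ∑ ∑ℕ

  ι-∑ : ∀ {n} (f : Fin n → ℕ) → ι (∑ℕ f) ≡ ∑ (λ i → ι (f i))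
  ι-∑ {zero}  f = ι-0
  ι-∑ {suc n} f = trans (ι-+ (f zero) _) (cong (ι (f zero) +_) (ι-∑ (λ i → f (suc i))))

  ∑-δ : ∀ {n} (i : Fin n) (f : Fin n → ℚ) → ∑ (λ j → ι (δ i j) * f j) ≡ f i
  ∑-δ {suc n} zero f = begin
    ι 1 * f zero + ∑ (λ j → ι 0 * f (suc j))
      ≡⟨ cong₂ _+_ (cong (_* f zero) ι-1) (∑-cong (λ j → cong (_* f (suc j)) ι-0)) ⟩
    1ℚ * f zero + ∑ (λ j → 0ℚ * f (suc j))
      ≡⟨ cong₂ _+_ (ℚ.*-identityˡ (f zero)) (trans (∑-cong (λ j → ℚ.*-zeroˡ (f (suc j)))) (∑-zero n)) ⟩
    f zero + 0ℚ ≡⟨ ℚ.+-identityʳ _ ⟩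
    f zero      ∎
    where open ≡-Reasoning
  ∑-δ {suc n} (suc i) f = begin
    ι 0 * f zero + ∑ (λ j → ι (δ (suc i) (suc j)) * f (suc j))
      ≡⟨ cong₂ _+_ (trans (cong (_* f zero) ι-0) (ℚ.*-zeroˡ (f zero)))
                   (∑-cong (λ j → cong (λ c → ι c * f (suc j)) (δ-suc i j))) ⟩
    0ℚ + ∑ (λ j → ι (δ i j) * f (suc j)) ≡⟨ ℚ.+-identityˡ _ ⟩
    ∑ (λ j → ι (δ i j) * f (suc j))      ≡⟨ ∑-δ i (λ j → f (suc j)) ⟩
    f (suc i)                            ∎
    where open ≡-Reasoning

∑-neg : ∀ {n} (f : Fin n → ℚ) → ∑ (λ i → - f i) ≡ - ∑ f
∑-neg f = begin
  ∑ (λ i → - f i)      ≡⟨ ∑-cong (λ i → neg-* (f i)) ⟩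
  ∑ (λ i → - 1ℚ * f i) ≡⟨ ∑-*ˡ (- 1ℚ) f ⟩
  - 1ℚ * ∑ f           ≡⟨ neg-* (∑ f) ⟨
  - ∑ f                ∎
  where
  open ≡-Reasoning
  neg-* : ∀ p → - p ≡ - 1ℚ * p
  neg-* = solve 1 (λ p → :- p := con (- 1ℚ) :* p) refl
    where open +-*-Solver

∑-- : ∀ {n} (f g : Fin n → ℚ) → ∑ (λ i → f i - g i) ≡ ∑ f - ∑ g
∑-- f g = trans (∑-+ f (λ i → - g i)) (cong (∑ f +_) (∑-neg g))

∑-*ʳ : ∀ {n} (f : Fin n → ℚ) c → ∑ (λ i → f i * c) ≡ ∑ f * c
∑-*ʳ f c = trans (∑-cong (λ i → ℚ.*-comm (f i) c)) (trans (∑-*ˡ c f) (ℚ.*-comm c (∑ f)))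

0≤∑ : ∀ {n} {f : Fin n → ℚ} → (∀ i → 0ℚ ≤ f i) → 0ℚ ≤ ∑ f
0≤∑ {n} {f} 0≤f = subst (_≤ ∑ f) (∑-zero n) (∑-mono 0≤f)

p+p≡2p : ∀ p → p + p ≡ 2ℚ * p
p+p≡2p = solve 1 (λ p → p :+ p := con 2ℚ :* p) refl
  where open +-*-Solver

∑∑ : ∀ {m n} → (Fin m → Fin n → ℚ) → ℚ
∑∑ f = ∑ λ a → ∑ (f a)

∑∑-cong : ∀ {m n} {f g : Fin m → Fin n → ℚ} → (∀ a b → f a b ≡ g a b) → ∑∑ f ≡ ∑∑ g
∑∑-cong eq = ∑-cong λ a → ∑-cong (eq a)

∑∑-mono : ∀ {m n} {f g : Fin m → Fin n → ℚ} → (∀ a b → f a b ≤ g a b) → ∑∑ f ≤ ∑∑ g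
∑∑-mono le = ∑-mono λ a → ∑-mono (le a)

∑∑-+ : ∀ {m n} (f g : Fin m → Fin n → ℚ) → ∑∑ (λ a b → f a b + g a b) ≡ ∑∑ f + ∑∑ g
∑∑-+ f g = trans (∑-cong λ a → ∑-+ (f a) (g a)) (∑-+ _ _)

∑∑-- : ∀ {m n} (f g : Fin m → Fin n → ℚ) → ∑∑ (λ a b → f a b - g a b) ≡ ∑∑ f - ∑∑ g
∑∑-- f g = trans (∑-cong λ a → ∑-- (f a) (g a)) (∑-- _ _)

∑∑-*ˡ : ∀ {m n} c (f : Fin m → Fin n → ℚ) → ∑∑ (λ a b → c * f a b) ≡ c * ∑∑ f
∑∑-*ˡ c f = trans (∑-cong λ a → ∑-*ˡ c (f a)) (∑-*ˡ c _)

∑-one : ∀ n → ∑ {n} (λ _ → 1ℚ) ≡ ι n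
∑-one n = trans (∑-cong {n} (λ _ → sym ι-1)) (trans (sym (ι-∑ {n} (λ _ → 1))) (cong ι (∑ℕ-one n)))

-- Energy of flows

A[_] : (G : Graph) → Fin (order G) → Fin (order G) → ℚ
A[ G ] a b = ι (edge G a b)

edge-sym : ∀ G a b → edge G a b ≡ edge G b a
edge-sym G a b with T? (Graph.adj G a b) | T? (Graph.adj G b a)
... | yes ab | yes ba = trans (edge-yes G ab) (sym (edge-yes G ba))
... | no ¬ab | no ¬ba = trans (edge-no G ¬ab) (sym (edge-no G ¬ba))
... | yes ab | no ¬ba = contradiction (Graph.symmetric G ab) ¬ba
... | no ¬ab | yes ba = contradiction (Graph.symmetric G ba) ¬ab

energy : (G : Graph) → (Fin (order G) → ℚ) → ℚ
energy G x = ∑∑ λ a b → A[ G ] a b * ((x b - x a) * (x b - x a))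

private
  -- For a potential difference g along a flow edge this is 2sg ≤ g² + s². The energy meets each
  -- edge as two ordered pairs, so both directions `h` and `h′` are charged to each pair; this gains
  -- a factor two in `bilinear`.
  edge-inequality : ∀ {A h h′} s p q → 0ℚ ≤ A → h ≡ 0ℚ ⊎ h ≡ 1ℚ × A ≡ 1ℚ → h′ ≡ 0ℚ ⊎ h′ ≡ 1ℚ × A ≡ 1ℚ →
    (2ℚ * s) * (h * (q - p)) + (2ℚ * s) * (h′ * (p - q)) ≤ A * ((q - p) * (q - p)) + (s * s) * (h + h′)
  edge-inequality {A} s p q 0≤A (inj₁ refl) (inj₁ refl) =
    ≤-by (A * ((q - p) * (q - p))) (0≤* 0≤A (0≤p² (q - p)))
      (solve 4 (λ A s p q → A :* ((q :- p) :* (q :- p)) :+ (s :* s) :* (con 0ℚ :+ con 0ℚ)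
        := ((con 2ℚ :* s) :* (con 0ℚ :* (q :- p)) :+ (con 2ℚ :* s) :* (con 0ℚ :* (p :- q)))
           :+ A :* ((q :- p) :* (q :- p))) refl A s p q)
    where open +-*-Solver
  edge-inequality s p q _ (inj₂ (refl , refl)) (inj₁ refl) =
    ≤-by ((q - p - s) * (q - p - s)) (0≤p² (q - p - s))
      (solve 3 (λ s p q → con 1ℚ :* ((q :- p) :* (q :- p)) :+ (s :* s) :* (con 1ℚ :+ con 0ℚ)
        := ((con 2ℚ :* s) :* (con 1ℚ :* (q :- p)) :+ (con 2ℚ :* s) :* (con 0ℚ :* (p :- q)))
           :+ (q :- p :- s) :* (q :- p :- s)) refl s p q)
    where open +-*-Solver
  edge-inequality s p q _ (inj₁ refl) (inj₂ (refl , refl)) =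
    ≤-by ((p - q - s) * (p - q - s)) (0≤p² (p - q - s))
      (solve 3 (λ s p q → con 1ℚ :* ((q :- p) :* (q :- p)) :+ (s :* s) :* (con 0ℚ :+ con 1ℚ)
        := ((con 2ℚ :* s) :* (con 0ℚ :* (q :- p)) :+ (con 2ℚ :* s) :* (con 1ℚ :* (p :- q)))
           :+ (p :- q :- s) :* (p :- q :- s)) refl s p q)
    where open +-*-Solver
  edge-inequality s p q _ (inj₂ (refl , refl)) (inj₂ (refl , _)) =
    ≤-by ((q - p) * (q - p) + (s * s + s * s)) (0≤+ (0≤p² (q - p)) (0≤+ (0≤p² s) (0≤p² s)))
      (solve 3 (λ s p q → con 1ℚ :* ((q :- p) :* (q :- p)) :+ (s :* s) :* (con 1ℚ :+ con 1ℚ)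
        := ((con 2ℚ :* s) :* (con 1ℚ :* (q :- p)) :+ (con 2ℚ :* s) :* (con 1ℚ :* (p :- q)))
           :+ ((q :- p) :* (q :- p) :+ (s :* s :+ s :* s))) refl s p q)
    where open +-*-Solver

module Thomson {G : Graph} {k : ℕ} {u i : Fin (order G)} (F : UnitFlow G k u i)
               (x : Fin (order G) → ℚ) where
  open UnitFlow F

  h : Fin (order G) → Fin (order G) → ℚ
  h a b = ι (flow a b)

  size : ℕ
  size = ∑ℕ (λ b → ∑ℕ (λ a → flow a b))

  ∑∑h : ∑∑ h ≡ ι size
  ∑∑h = trans (∑-comm h) (trans (∑-cong (λ b → sym (ι-∑ (λ a → flow a b)))) (sym (ι-∑ _)))

  drop : Fin (order G) → Fin (order G) → ℚ
  drop a b = h a b * (x b - x a)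

  -- Summation by parts, then conservation at every vertex.
  ∑∑drop : ∑∑ drop ≡ ι k * (x i - x u)
  ∑∑drop = begin
    ∑∑ drop ≡⟨ ∑∑-cong (λ a b → distrib (h a b) (x b) (x a)) ⟩
    ∑∑ (λ a b → h a b * x b - h a b * x a) ≡⟨ ∑∑-- _ _ ⟩
    ∑∑ (λ a b → h a b * x b) - ∑∑ (λ a b → h a b * x a)
      ≡⟨ cong₂ _-_ (trans (∑-comm _) (∑-cong λ b → ∑-*ʳ (λ a → h a b) (x b)))
                   (∑-cong λ a → ∑-*ʳ (h a) (x a)) ⟩
    ∑ (λ b → ∑ (λ a → h a b) * x b) - ∑ (λ b → ∑ (h b) * x b) ≡⟨ ∑-- _ _ ⟨
    ∑ (λ b → ∑ (λ a → h a b) * x b - ∑ (h b) * x b)           ≡⟨ ∑-cong pointwise ⟩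
    ∑ (λ b → ι k * (ι (δ i b) * x b) - ι k * (ι (δ u b) * x b)) ≡⟨ ∑-- _ _ ⟩
    ∑ (λ b → ι k * (ι (δ i b) * x b)) - ∑ (λ b → ι k * (ι (δ u b) * x b))
      ≡⟨ cong₂ _-_ (trans (∑-*ˡ (ι k) _) (cong (ι k *_) (∑-δ i x)))
                   (trans (∑-*ˡ (ι k) _) (cong (ι k *_) (∑-δ u x))) ⟩
    ι k * x i - ι k * x u ≡⟨ distrib (ι k) (x i) (x u) ⟨
    ι k * (x i - x u) ∎
    where
    open ≡-Reasoning
    distrib : ∀ h p q → h * (p - q) ≡ h * p - h * q
    distrib = solve 3 (λ h p q → h :* (p :- q) := h :* p :- h :* q) refl
      where open +-*-Solver
    cast : ∀ m v b → ι (m ℕ.+ k ℕ.* δ v b) ≡ ι m + ι k * ι (δ v b)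
    cast m v b = trans (ι-+ m _) (cong (ι m +_) (ι-* k _))
    inflow outflow : Fin (order G) → ℕ
    inflow b = ∑ℕ (λ a → flow a b)
    outflow b = ∑ℕ (flow b)
    pointwise : ∀ b → ∑ (λ a → h a b) * x b - ∑ (h b) * x b
                    ≡ ι k * (ι (δ i b) * x b) - ι k * (ι (δ u b) * x b)
    pointwise b = begin
      ∑ (λ a → h a b) * x b - ∑ (h b) * x b
        ≡⟨ cong₂ (λ p q → p * x b - q * x b) (sym (ι-∑ (λ a → flow a b))) (sym (ι-∑ (flow b))) ⟩
      ι (inflow b) * x b - ι (outflow b) * x b
        ≡⟨ step₁ (ι (inflow b)) (ι (outflow b)) (ι k) (ι (δ u b)) (x b) ⟩
      (ι (inflow b) + ι k * ι (δ u b)) * x b - (ι (outflow b) + ι k * ι (δ u b)) * x b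
        ≡⟨ cong (λ p → p * x b - (ι (outflow b) + ι k * ι (δ u b)) * x b) eq ⟩
      (ι (outflow b) + ι k * ι (δ i b)) * x b - (ι (outflow b) + ι k * ι (δ u b)) * x b
        ≡⟨ step₂ (ι (outflow b)) (ι k) (ι (δ i b)) (ι (δ u b)) (x b) ⟩
      ι k * (ι (δ i b) * x b) - ι k * (ι (δ u b) * x b) ∎
      where
      eq : ι (inflow b) + ι k * ι (δ u b) ≡ ι (outflow b) + ι k * ι (δ i b)
      eq = trans (sym (cast (inflow b) u b)) (trans (cong ι (conservation b)) (cast (outflow b) i b))
      step₁ : ∀ m n k d x → m * x - n * x ≡ (m + k * d) * x - (n + k * d) * x
      step₁ = solve 5 (λ m n k d x → m :* x :- n :* x := (m :+ k :* d) :* x :- (n :+ k :* d) :* x) refl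
        where open +-*-Solver
      step₂ : ∀ n k d e x → (n + k * d) * x - (n + k * e) * x ≡ k * (d * x) - k * (e * x)
      step₂ = solve 5 (λ n k d e x → (n :+ k :* d) :* x :- (n :+ k :* e) :* x
          := k :* (d :* x) :- k :* (e :* x)) refl
        where open +-*-Solver

  bilinear : ∀ s → (4ℚ * s) * (ι k * (x i - x u)) ≤ energy G x + (2ℚ * (s * s)) * ι size
  bilinear s = subst₂ _≤_ left right (∑∑-mono pointwise)
    where
    open ≡-Reasoning
    unit′ : ∀ a b → h a b ≡ 0ℚ ⊎ h a b ≡ 1ℚ × A[ G ] a b ≡ 1ℚ
    unit′ a b with unit a b
    ... | inj₁ eq        = inj₁ (trans (cong ι eq) ι-0)
    ... | inj₂ (eq , ab) = inj₂ (trans (cong ι eq) ι-1 , trans (cong ι (edge-yes G ab)) ι-1)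
    unit″ : ∀ a b → h b a ≡ 0ℚ ⊎ h b a ≡ 1ℚ × A[ G ] a b ≡ 1ℚ
    unit″ a b with unit′ b a
    ... | inj₁ eq       = inj₁ eq
    ... | inj₂ (eq , A) = inj₂ (eq , trans (cong ι (edge-sym G a b)) A)
    pointwise : ∀ a b → (2ℚ * s) * drop a b + (2ℚ * s) * drop b a
                      ≤ A[ G ] a b * ((x b - x a) * (x b - x a)) + (s * s) * (h a b + h b a)
    pointwise a b = edge-inequality s (x a) (x b) (0≤ι _) (unit′ a b) (unit″ a b)
    left : ∑∑ (λ a b → (2ℚ * s) * drop a b + (2ℚ * s) * drop b a) ≡ (4ℚ * s) * (ι k * (x i - x u))
    left = begin
      ∑∑ (λ a b → (2ℚ * s) * drop a b + (2ℚ * s) * drop b a) ≡⟨ ∑∑-+ _ _ ⟩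
      ∑∑ (λ a b → (2ℚ * s) * drop a b) + ∑∑ (λ a b → (2ℚ * s) * drop b a)
        ≡⟨ cong₂ _+_ (∑∑-*ˡ (2ℚ * s) drop) (trans (∑∑-*ˡ (2ℚ * s) (λ a b → drop b a)) (cong ((2ℚ * s) *_)
            (sym (∑-comm drop)))) ⟩
      (2ℚ * s) * ∑∑ drop + (2ℚ * s) * ∑∑ drop ≡⟨ double s (∑∑ drop) ⟩
      (4ℚ * s) * ∑∑ drop ≡⟨ cong ((4ℚ * s) *_) ∑∑drop ⟩
      (4ℚ * s) * (ι k * (x i - x u)) ∎
      where
      double : ∀ s d → (2ℚ * s) * d + (2ℚ * s) * d ≡ (4ℚ * s) * d
      double = solve 2 (λ s d → (con 2ℚ :* s) :* d :+ (con 2ℚ :* s) :* d := (con 4ℚ :* s) :* d) refl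
        where open +-*-Solver
    right : ∑∑ (λ a b → A[ G ] a b * ((x b - x a) * (x b - x a)) + (s * s) * (h a b + h b a))
          ≡ energy G x + (2ℚ * (s * s)) * ι size
    right = begin
      ∑∑ (λ a b → A[ G ] a b * ((x b - x a) * (x b - x a)) + (s * s) * (h a b + h b a)) ≡⟨ ∑∑-+ _ _ ⟩
      energy G x + ∑∑ (λ a b → (s * s) * (h a b + h b a))
        ≡⟨ cong (energy G x +_) (trans (∑∑-*ˡ (s * s) (λ a b → h a b
            + h b a)) (cong ((s * s) *_) (∑∑-+ h (λ a b → h b a)))) ⟩
      energy G x + (s * s) * (∑∑ h + ∑∑ (λ a b → h b a))
        ≡⟨ cong (λ t → energy G x + (s * s) * t) (cong₂ _+_ ∑∑h (trans (sym (∑-comm h)) ∑∑h)) ⟩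
      energy G x + (s * s) * (ι size + ι size) ≡⟨ cong (energy G x +_) (double (s * s) (ι size)) ⟩
      energy G x + (2ℚ * (s * s)) * ι size ∎
      where
      double : ∀ s d → s * (d + d) ≡ (2ℚ * s) * d
      double = solve 2 (λ s d → s :* (d :+ d) := (con 2ℚ :* s) :* d) refl
        where open +-*-Solver

  -- Optimising over the multiple s of the flow is the Cauchy–Schwarz inequality.
  potential-bound : ∀ D → 0ℚ < ι k * ι k + D → ι size ≤ D →
    2ℚ * ((ι k * ι k) * (x i * x i)) ≤ (ι k * ι k + D) * (energy G x + 2ℚ * (x u * x u))
  potential-bound D 0<K size≤D = begin
    2ℚ * ((κ * κ) * (M * M))     ≡⟨ reg₁ κ M ⟩
    2ℚ * ((κ * M) * (κ * M))     ≡⟨ cong₂ (λ c d → 2ℚ * (c * d)) Ks Ks ⟨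
    2ℚ * ((K * s) * (K * s))     ≡⟨ reg₂ K s ⟩
    K * (2ℚ * (s * s) * K)       ≤⟨ ℚ.*-monoˡ-≤-nonNeg K {{ℚ.pos⇒nonNeg K}} key ⟩
    K * (E + 2ℚ * (t * t))       ∎
    where
    open ℚ.≤-Reasoning
    κ K M t E : ℚ
    κ = ι k
    K = ι k * ι k + D
    M = x i
    t = x u
    E = energy G x
    instance
      K-positive : Positive K
      K-positive = positive 0<K
      K-nonZero : ℚ.NonZero K
      K-nonZero = ℚ.pos⇒nonZero K
    -- The maximiser of 4sκM - 2s²K, where the value is 2κ²M²/K.
    s : ℚ
    s = 1/ K * (κ * M)
    Ks : K * s ≡ κ * M
    Ks = trans (sym (ℚ.*-assoc K (1/ K) (κ * M)))
           (trans (cong (_* (κ * M)) (ℚ.*-inverseʳ K)) (ℚ.*-identityˡ (κ * M)))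
    reg₁ : ∀ κ M → 2ℚ * ((κ * κ) * (M * M)) ≡ 2ℚ * ((κ * M) * (κ * M))
    reg₁ = solve 2 (λ κ M → con 2ℚ :* ((κ :* κ) :* (M :* M)) := con 2ℚ :* ((κ :* M) :* (κ :* M))) refl
      where open +-*-Solver
    reg₂ : ∀ K s → 2ℚ * ((K * s) * (K * s)) ≡ K * (2ℚ * (s * s) * K)
    reg₂ = solve 2 (λ K s → con 2ℚ :* ((K :* s) :* (K :* s)) := K :* (con 2ℚ :* (s :* s) :* K)) refl
      where open +-*-Solver
    key : 2ℚ * (s * s) * K ≤ E + 2ℚ * (t * t)
    key = ≤-by d 0≤d (begin-equality
      E + 2ℚ * (t * t) ≡⟨ cancel (E + 2ℚ * (t * t)) s (κ * M) ⟩
      E + 2ℚ * (t * t) + 4ℚ * s * (κ * M - κ * M)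
        ≡⟨ cong (λ c → E + 2ℚ * (t * t) + 4ℚ * s * (c - κ * M)) Ks ⟨
      E + 2ℚ * (t * t) + 4ℚ * s * (K * s - κ * M) ≡⟨ identity E D (ι size) κ s M t ⟩
      2ℚ * (s * s) * K + d ∎)
      where
      -- The last square removes the potential at `u`, by 4sκt ≤ 2t² + 2s²κ². This is why κ² joins D
      -- in `K`.
      d : ℚ
      d = ((E + (2ℚ * (s * s)) * ι size) - (4ℚ * s) * (κ * (M - t)))
          + ((2ℚ * (s * s)) * (D - ι size) + 2ℚ * ((t - s * κ) * (t - s * κ)))
      0≤d : 0ℚ ≤ d
      0≤d = 0≤+ (≤⇒0≤- (bilinear s))
        (0≤+ (0≤* (0≤* 0≤2ℚ (0≤p² s)) (≤⇒0≤- size≤D)) (0≤* 0≤2ℚ (0≤p² (t - s * κ))))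
      cancel : ∀ a s c → a ≡ a + 4ℚ * s * (c - c)
      cancel = solve 3 (λ a s c → a := a :+ con 4ℚ :* s :* (c :- c)) refl
        where open +-*-Solver
      identity : ∀ E D z κ s M t →
        E + 2ℚ * (t * t) + 4ℚ * s * ((κ * κ + D) * s - κ * M)
        ≡ 2ℚ * (s * s) * (κ * κ + D) + (((E + (2ℚ * (s * s)) * z) - (4ℚ * s) * (κ * (M - t)))
          + ((2ℚ * (s * s)) * (D - z) + 2ℚ * ((t - s * κ) * (t - s * κ))))
      identity = solve 7 (λ E D z κ s M t →
        E :+ con 2ℚ :* (t :* t) :+ con 4ℚ :* s :* ((κ :* κ :+ D) :* s :- κ :* M)
        := con 2ℚ :* (s :* s) :* (κ :* κ :+ D) :+ (((E
            :+ (con 2ℚ :* (s :* s)) :* z) :- (con 4ℚ :* s) :* (κ :* (M :- t)))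
          :+ ((con 2ℚ :* (s :* s)) :* (D :- z) :+ con 2ℚ :* ((t :- s :* κ) :* (t :- s :* κ))))) refl
        where open +-*-Solver

-- The quadratic form of a regular graph with a distinguished edge

0<ι : ∀ {n} → 1 ℕ.≤ n → 0ℚ < ι n
0<ι 1≤n = ℚ.<-≤-trans (subst (0ℚ <_) (sym ι-1) (ℚ.positive⁻¹ 1ℚ)) (ι-mono 1≤n)

adjacency-form : (G : Graph) → (Fin (order G) → ℚ) → ℚ
adjacency-form G x = ∑∑ λ a b → A[ G ] a b * (x a * x b)

∑A : ∀ G a → ∑ (A[ G ] a) ≡ ι (Graph.degree G a)
∑A G a = trans (sym (ι-∑ (edge G a))) (cong ι (sym (degree≡∑ G a)))

energy-identity : ∀ {Δ} G → Regular Δ G → ∀ x →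
  energy G x ≡ 2ℚ * (ι Δ * ∑ (λ a → x a * x a)) - 2ℚ * adjacency-form G x
energy-identity {Δ} G regular x = begin
  energy G x ≡⟨ ∑∑-cong (λ a b → expand (A[ G ] a b) (x a) (x b)) ⟩
  ∑∑ (λ a b → (A[ G ] a b * sq a + A[ G ] a b * sq b) - 2ℚ * (A[ G ] a b * (x a * x b))) ≡⟨ ∑∑-- _ _ ⟩
  ∑∑ (λ a b → A[ G ] a b * sq a + A[ G ] a b * sq b) - ∑∑ (λ a b → 2ℚ * (A[ G ] a b * (x a * x b)))
    ≡⟨ cong₂ _-_ (trans (∑∑-+ _ _) (cong₂ _+_ row column)) (∑∑-*ˡ 2ℚ _) ⟩
  (ι Δ * ∑ sq + ι Δ * ∑ sq) - 2ℚ * adjacency-form G x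
      ≡⟨ cong (_- 2ℚ * adjacency-form G x) (p+p≡2p (ι Δ * ∑ sq)) ⟩
  2ℚ * (ι Δ * ∑ sq) - 2ℚ * adjacency-form G x ∎
  where
  open ≡-Reasoning
  sq : Fin (order G) → ℚ
  sq a = x a * x a
  row : ∑∑ (λ a b → A[ G ] a b * sq a) ≡ ι Δ * ∑ sq
  row = trans (∑-cong λ a → trans (∑-*ʳ (A[ G ] a) (sq a)) (cong (_* sq a) (trans (∑A G a) (cong ι
      (regular a)))))
              (∑-*ˡ (ι Δ) sq)
  column : ∑∑ (λ a b → A[ G ] a b * sq b) ≡ ι Δ * ∑ sq
  column = trans (∑-comm _) (trans (∑∑-cong λ b a → cong (λ e → ι e * sq b) (edge-sym G a b)) row)
  expand : ∀ A p q → A * ((q - p) * (q - p)) ≡ (A * (p * p) + A * (q * q)) - 2ℚ * (A * (p * q))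
  expand = solve 3 (λ A p q → A :* ((q :- p) :* (q :- p))
      := (A :* (p :* p) :+ A :* (q :* q)) :- con 2ℚ :* (A :* (p :* q))) refl
    where open +-*-Solver

-- Each edge at `u` enters the energy as (u, b) and as (b, u).
energy-at : ∀ G x u → 2ℚ * ∑ (λ b → A[ G ] u b * ((x b - x u) * (x b - x u))) ≤ energy G x
energy-at G x u = subst (_≤ energy G x) eq (∑∑-mono pointwise)
  where
  open ≡-Reasoning
  T : Fin (order G) → Fin (order G) → ℚ
  T a b = A[ G ] a b * ((x b - x a) * (x b - x a))
  0≤T : ∀ a b → 0ℚ ≤ T a b
  0≤T a b = 0≤* (0≤ι _) (0≤p² (x b - x a))
  T-sym : ∀ a b → T a b ≡ T b a
  T-sym a b = trans (cong (λ e → ι e * ((x b - x a) * (x b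
      - x a))) (edge-sym G a b)) (flip (A[ G ] b a) (x a) (x b))
    where
    flip : ∀ e p q → e * ((q - p) * (q - p)) ≡ e * ((p - q) * (p - q))
    flip = solve 3 (λ e p q → e :* ((q :- p) :* (q :- p)) := e :* ((p :- q) :* (p :- q))) refl
      where open +-*-Solver
  pointwise : ∀ a b → ι (δ u a) * T a b + ι (δ u b) * T a b ≤ T a b
  pointwise a b with u Fin.≟ a | u Fin.≟ b
  ... | yes refl | yes refl = ≤-by 0ℚ ℚ.≤-refl (vanish (A[ G ] a a) (ι 1) (x a))
    where
    vanish : ∀ e c p → e * ((p - p) * (p - p)) ≡ (c * (e * ((p - p) * (p - p)))
        + c * (e * ((p - p) * (p - p)))) + 0ℚ
    vanish = solve 3 (λ e c p → e :* ((p :- p) :* (p :- p))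
        := (c :* (e :* ((p :- p) :* (p :- p))) :+ c :* (e :* ((p :- p) :* (p :- p)))) :+ con 0ℚ) refl
      where open +-*-Solver
  ... | yes _ | no _ rewrite ι-0 | ι-1 = ℚ.≤-reflexive (trans (cong₂ _+_ (ℚ.*-identityˡ (T a b))
      (ℚ.*-zeroˡ (T a b))) (ℚ.+-identityʳ _))
  ... | no _ | yes _ rewrite ι-0 | ι-1 = ℚ.≤-reflexive (trans (cong₂ _+_ (ℚ.*-zeroˡ (T a b))
      (ℚ.*-identityˡ (T a b))) (ℚ.+-identityˡ _))
  ... | no _ | no _ rewrite ι-0 = subst (_≤ T a b) (sym (trans (cong₂ _+_ (ℚ.*-zeroˡ (T a b)) (ℚ.*-zeroˡ
      (T a b))) (ℚ.+-identityˡ 0ℚ))) (0≤T a b)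
  eq : ∑∑ (λ a b → ι (δ u a) * T a b + ι (δ u b) * T a b) ≡ 2ℚ * ∑ (T u)
  eq = begin
    ∑∑ (λ a b → ι (δ u a) * T a b + ι (δ u b) * T a b) ≡⟨ ∑∑-+ _ _ ⟩
    ∑∑ (λ a b → ι (δ u a) * T a b) + ∑∑ (λ a b → ι (δ u b) * T a b)
      ≡⟨ cong₂ _+_ (trans (∑-cong λ a → ∑-*ˡ (ι (δ u a)) (T a)) (∑-δ u (λ a → ∑ (T a))))
                   (∑-cong λ a → ∑-δ u (T a)) ⟩
    ∑ (T u) + ∑ (λ a → T a u) ≡⟨ cong (∑ (T u) +_) (∑-cong λ a → T-sym a u) ⟩
    ∑ (T u) + ∑ (T u)         ≡⟨ p+p≡2p (∑ (T u)) ⟩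
    2ℚ * ∑ (T u)              ∎

module Core (k : ℕ) (1≤k : 1 ℕ.≤ k) (Δ : ℕ) (G : Graph)
            (connected : Connected[ k ] G) (regular : Regular Δ G) where

  n : ℕ
  n = order G

  κ m N D : ℚ
  κ = ι k
  m = ι Δ
  N = ι n
  D = ((N - m) + 2ℚ * κ) - 2ℚ

  module _ (u v : Fin n) (uv : Graph.Adjacent G u v) (x : Fin n → ℚ) (0≤x : ∀ a → 0ℚ ≤ x a) where

    t y E X S : ℚ
    t = x u
    y = x v
    E = energy G x
    X = ∑ (λ a → x a * x a)
    S = adjacency-form G x

    e : Fin n → ℚ
    e = A[ G ] u

    Q : ℚ
    Q = E + 4ℚ * (t * y)

    P Y : ℚ
    P = ∑ (λ a → e a * (x a * x a))
    Y = ∑ (λ a → e a * ((x a - t) * (x a - t)))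

    1≤Δ : 1 ℕ.≤ Δ
    1≤Δ = subst₂ ℕ._≤_ (edge-yes G uv) (trans (sym (degree≡∑ G u)) (regular u)) (entry≤∑ℕ (edge G u) v)

    ∑e : ∑ e ≡ m
    ∑e = trans (∑A G u) (cong ι (regular u))

    instance
      m-positive : Positive m
      m-positive = positive (0<ι 1≤Δ)

    0≤E : 0ℚ ≤ E
    0≤E = 0≤∑ λ a → 0≤∑ λ b → 0≤* (0≤ι _) (0≤p² (x b - x a))

    0≤ty : 0ℚ ≤ t * y
    0≤ty = 0≤* (0≤x u) (0≤x v)

    0≤Q : 0ℚ ≤ Q
    0≤Q = 0≤+ 0≤E (0≤* 0≤4ℚ 0≤ty)

    -- Here z is the value at a neighbour of `u`. The coefficient 8m + 2 is dictated by `star`,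
    -- where 2(8m + 2) + 8 = 4(4m + 3). That 4m + 3 suffices in place of 4m + 4 is the source of the
    -- final slack, and uses m ≥ 1. The factor m is common to all terms after summing over the m
    -- neighbours, and cancels.
    spoke : ∀ z → (4ℚ * m) * (z * z) ≤ (8ℚ * m + 2ℚ) * (t * t) + (m * (4ℚ * m + 3ℚ)) * ((z - t) * (z - t))
    spoke z = ≤-by (⅓ * sos) (0≤* (ℚ.nonNegative⁻¹ ⅓) 0≤sos) (identity m t z)
      where
      r w : ℚ
      r = m - 1ℚ
      w = z - t
      0≤r : 0ℚ ≤ r
      0≤r = ≤⇒0≤- (subst (_≤ m) ι-1 (ι-mono 1≤Δ))
      -- Three times the difference of the two sides.
      sos : ℚ
      sos = (2ℚ * ((3ℚ * t - 2ℚ * w) * (3ℚ * t - 2ℚ * w)) + w * w)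
            + ((12ℚ * r) * ((t - w) * (t - w)) + ((3ℚ * r) * (3ℚ + 4ℚ * r)) * (w * w))
      0≤sos : 0ℚ ≤ sos
      0≤sos = 0≤+ (0≤+ (0≤* 0≤2ℚ (0≤p² (3ℚ * t - 2ℚ * w))) (0≤p² w))
                  (0≤+ (0≤* (0≤* (ℚ.nonNegative⁻¹ 12ℚ) 0≤r) (0≤p² (t - w)))
                       (0≤* (0≤* (0≤* 0≤3ℚ 0≤r) (0≤+ 0≤3ℚ (0≤* 0≤4ℚ 0≤r))) (0≤p² w)))
      identity : ∀ m t z → (8ℚ * m + 2ℚ) * (t * t) + (m * (4ℚ * m + 3ℚ)) * ((z - t) * (z - t))
        ≡ (4ℚ * m) * (z * z) + ⅓ * ((2ℚ * ((3ℚ * t - 2ℚ * (z - t)) * (3ℚ * t - 2ℚ * (z - t)))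
            + (z - t) * (z - t))
            + ((12ℚ * (m - 1ℚ)) * ((t - (z - t)) * (t - (z - t))) + ((3ℚ * (m - 1ℚ)) * (3ℚ
                + 4ℚ * (m - 1ℚ))) * ((z - t) * (z - t))))
      identity = solve 3 (λ m t z → (con 8ℚ :* m :+ con 2ℚ) :* (t :* t) :+ (m :* (con 4ℚ :* m
          :+ con 3ℚ)) :* ((z :- t) :* (z :- t))
        := (con 4ℚ :* m) :* (z :* z) :+ con ⅓ :* ((con 2ℚ :* ((con 3ℚ :* t :- con 2ℚ :* (z :- t)) :*
            (con 3ℚ :* t :- con 2ℚ :* (z :- t))) :+ (z :- t) :* (z :- t))
            :+ ((con 12ℚ :* (m :- con 1ℚ)) :* ((t :- (z :- t)) :* (t :- (z :- t)))
                :+ ((con 3ℚ :* (m :- con 1ℚ)) :* (con 3ℚ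
                :+ con 4ℚ :* (m :- con 1ℚ))) :* ((z :- t) :* (z :- t))))) refl
        where open +-*-Solver

    spokes : 4ℚ * P ≤ (8ℚ * m + 2ℚ) * (t * t) + (4ℚ * m + 3ℚ) * Y
    spokes = ℚ.*-cancelˡ-≤-pos m (subst₂ _≤_ left right (∑-mono λ a →
               ℚ.*-monoˡ-≤-nonNeg (e a) {{nonNegative (0≤ι _)}} (spoke (x a))))
      where
      open ≡-Reasoning
      α β : ℚ
      α = (8ℚ * m + 2ℚ) * (t * t)
      β = m * (4ℚ * m + 3ℚ)
      left : ∑ (λ a → e a * ((4ℚ * m) * (x a * x a))) ≡ m * (4ℚ * P)
      left = begin
        ∑ (λ a → e a * ((4ℚ * m) * (x a * x a))) ≡⟨ ∑-cong (λ a → regroup (e a) m (x a)) ⟩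
        ∑ (λ a → (m * 4ℚ) * (e a * (x a * x a))) ≡⟨ ∑-*ˡ (m * 4ℚ) _ ⟩
        (m * 4ℚ) * P                             ≡⟨ ℚ.*-assoc m 4ℚ P ⟩
        m * (4ℚ * P)                             ∎
        where
        regroup : ∀ e m x → e * ((4ℚ * m) * (x * x)) ≡ (m * 4ℚ) * (e * (x * x))
        regroup = solve 3 (λ e m x → e :* ((con 4ℚ :* m) :* (x :* x)) := (m :* con 4ℚ) :* (e :* (x :* x))) refl
          where open +-*-Solver
      right : ∑ (λ a → e a * (α + β * ((x a - t) * (x a - t)))) ≡ m * (α + (4ℚ * m + 3ℚ) * Y)
      right = begin
        ∑ (λ a → e a * (α + β * ((x a - t) * (x a - t))))
            ≡⟨ ∑-cong (λ a → regroup (e a) α β ((x a - t) * (x a - t))) ⟩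
        ∑ (λ a → α * e a + β * (e a * ((x a - t) * (x a - t)))) ≡⟨ ∑-+ _ _ ⟩
        ∑ (λ a → α * e a) + ∑ (λ a → β * (e a * ((x a - t) * (x a - t))))
          ≡⟨ cong₂ _+_ (trans (∑-*ˡ α e) (cong (α *_) ∑e)) (∑-*ˡ β _) ⟩
        α * m + β * Y ≡⟨ factor α m (4ℚ * m + 3ℚ) Y ⟩
        m * (α + (4ℚ * m + 3ℚ) * Y) ∎
        where
        regroup : ∀ e α β z → e * (α + β * z) ≡ α * e + β * (e * z)
        regroup = solve 4 (λ e α β z → e :* (α :+ β :* z) := α :* e :+ β :* (e :* z)) refl
          where open +-*-Solver
        factor : ∀ α m c Y → α * m + (m * c) * Y ≡ m * (α + c * Y)
        factor = solve 4 (λ α m c Y → α :* m :+ (m :* c) :* Y := m :* (α :+ c :* Y)) refl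
          where open +-*-Solver

    module _ (t≤y : t ≤ y) where

      tt≤ty : t * t ≤ t * y
      tt≤ty = ℚ.*-monoˡ-≤-nonNeg t {{nonNegative (0≤x u)}} t≤y

      -- Doubling `spokes` gives 4(4m + 3)t² in total, which the missing edge pays because t² ≤ ty;
      -- the energy at `u` pays for `Y`.
      star : 8ℚ * (t * t + P) ≤ (4ℚ * m + 3ℚ) * Q
      star = ≤-by d 0≤d (identity m t y E P Y)
        where
        c d : ℚ
        c = 4ℚ * m + 3ℚ
        d = 2ℚ * (((8ℚ * m + 2ℚ) * (t * t) + c * Y) - 4ℚ * P) + c * ((E - 2ℚ * Y) + 4ℚ * (t * y - t * t))
        0≤d : 0ℚ ≤ d
        0≤d = 0≤+ (0≤* 0≤2ℚ (≤⇒0≤- spokes))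
          (0≤* (0≤+ (0≤* 0≤4ℚ (0≤ι Δ)) 0≤3ℚ) (0≤+ (≤⇒0≤- (energy-at G x u)) (0≤* 0≤4ℚ (≤⇒0≤- tt≤ty))))
        identity : ∀ m t y E P Y → (4ℚ * m + 3ℚ) * (E + 4ℚ * (t * y)) ≡ 8ℚ * (t * t + P) +
          (2ℚ * (((8ℚ * m + 2ℚ) * (t * t) + (4ℚ * m + 3ℚ) * Y) - 4ℚ * P) + (4ℚ * m + 3ℚ) * ((E - 2ℚ * Y)
              + 4ℚ * (t * y - t * t)))
        identity = solve 6 (λ m t y E P Y → (con 4ℚ :* m :+ con 3ℚ) :* (E :+ con 4ℚ :* (t :* y))
            := con 8ℚ :* (t :* t :+ P) :+
          (con 2ℚ :* (((con 8ℚ :* m :+ con 2ℚ) :* (t :* t) :+ (con 4ℚ :* m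
              :+ con 3ℚ) :* Y) :- con 4ℚ :* P) :+ (con 4ℚ :* m :+ con 3ℚ) :* ((E :- con 2ℚ :* Y)
              :+ con 4ℚ :* (t :* y :- t :* t)))) refl
          where open +-*-Solver

      -- `potential-bound` leaves the term 2t², and the missing edge pays for it because t² ≤ ty.
      distant : ∀ i → u ≢ i → ¬ Graph.Adjacent G u i →
        2ℚ * ((κ * κ) * (x i * x i)) ≤ (κ * κ + D) * Q
      distant i u≢i u≁i = ℚ.≤-trans (Thomson.potential-bound F x D 0<K size≤D)
        (ℚ.*-monoˡ-≤-nonNeg (κ * κ + D) {{nonNegative (ℚ.<⇒≤ 0<K)}} (ℚ.+-monoʳ-≤ E widen))
        where
        F : UnitFlow G k u i
        F = Menger.unitFlow G k connected u i u≢i u≁i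
        size : ℕ
        size = Thomson.size F x
        size≤D : ι size ≤ D
        size≤D = ≤-by (((N + 2ℚ * κ) - ((ι size + m) + 2ℚ))) (≤⇒0≤- (subst₂ _≤_ cast₁ cast₂ (ι-mono total′)))
          (identity N m κ (ι size))
          where
          total′ : size ℕ.+ Δ ℕ.+ 2 ℕ.≤ n ℕ.+ 2 ℕ.* k
          total′ = subst (λ c → size ℕ.+ c ℕ.+ 2 ℕ.≤ n ℕ.+ 2 ℕ.* k) (regular u) (UnitFlow.total F)
          cast₁ : ι (size ℕ.+ Δ ℕ.+ 2) ≡ (ι size + m) + 2ℚ
          cast₁ = trans (ι-+ (size ℕ.+ Δ) 2) (cong₂ _+_ (ι-+ size Δ) ι-2)
          cast₂ : ι (n ℕ.+ 2 ℕ.* k) ≡ N + 2ℚ * κ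
          cast₂ = trans (ι-+ n _) (cong (N +_) (trans (ι-* 2 k) (cong (_* κ) ι-2)))
          identity : ∀ N m κ s → ((N - m) + 2ℚ * κ) - 2ℚ ≡ s + ((N + 2ℚ * κ) - ((s + m) + 2ℚ))
          identity = solve 4 (λ N m κ s → ((N :- m) :+ con 2ℚ :* κ) :- con 2ℚ
              := s :+ ((N :+ con 2ℚ :* κ) :- ((s :+ m) :+ con 2ℚ))) refl
            where open +-*-Solver
        0<K : 0ℚ < κ * κ + D
        0<K = ℚ.+-mono-<-≤ {0ℚ} {κ * κ} {0ℚ} {D} (ℚ.positive⁻¹ (κ * κ) {{ℚ.pos*pos⇒pos κ {{κ⁺}} κ {{κ⁺}}}})
                (ℚ.≤-trans (0≤ι size) size≤D)
          where
          κ⁺ : Positive κ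
          κ⁺ = positive (0<ι 1≤k)
        widen : 2ℚ * (t * t) ≤ 4ℚ * (t * y)
        widen = ≤-by (4ℚ * (t * y - t * t) + 2ℚ * (t * t))
          (0≤+ (0≤* 0≤4ℚ (≤⇒0≤- tt≤ty)) (0≤* 0≤2ℚ (0≤p² t))) (identity t y)
          where
          identity : ∀ t y → 4ℚ * (t * y) ≡ 2ℚ * (t * t) + (4ℚ * (t * y - t * t) + 2ℚ * (t * t))
          identity = solve 2 (λ t y → con 4ℚ :* (t :* y)
              := con 2ℚ :* (t :* t) :+ (con 4ℚ :* (t :* y :- t :* t) :+ con 2ℚ :* (t :* t))) refl
            where open +-*-Solver

      -- The weight `w` will be the indicator of the closed neighbourhood of `u`. One formula for
      -- both kinds of vertices allows a single sum; those with w = 1 are left to `star`.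
      weighted-bound : ∀ i {w} → w ≡ 1ℚ ⊎ w ≡ 0ℚ × u ≢ i × ¬ Graph.Adjacent G u i →
        (8ℚ * (κ * κ)) * (x i * x i) ≤ (8ℚ * (κ * κ)) * (w * (x i * x i)) + (4ℚ * ((κ * κ + D) * Q)) * (1ℚ - w)
      weighted-bound i (inj₁ refl) = ℚ.≤-reflexive (near (8ℚ * (κ * κ)) (x i * x i) (4ℚ * ((κ * κ + D) * Q)))
        where
        near : ∀ c z r → c * z ≡ c * (1ℚ * z) + r * (1ℚ - 1ℚ)
        near = solve 3 (λ c z r → c :* z := c :* (con 1ℚ :* z) :+ r :* (con 1ℚ :- con 1ℚ)) refl
          where open +-*-Solver
      weighted-bound i (inj₂ (refl , u≢i , u≁i)) =
        ≤-by (4ℚ * ((κ * κ + D) * Q - 2ℚ * ((κ * κ) * (x i * x i))))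
          (0≤* 0≤4ℚ (≤⇒0≤- (distant i u≢i u≁i))) (far (κ * κ) (x i * x i) ((κ * κ + D) * Q))
        where
        far : ∀ c z r → (8ℚ * c) * (0ℚ * z) + (4ℚ * r) * (1ℚ - 0ℚ) ≡ (8ℚ * c) * z + 4ℚ * (r - 2ℚ * (c * z))
        far = solve 3 (λ c z r → (con 8ℚ :* c) :* (con 0ℚ :* z) :+ (con 4ℚ :* r) :* (con 1ℚ :- con 0ℚ)
            := (con 8ℚ :* c) :* z :+ con 4ℚ :* (r :- con 2ℚ :* (c :* z))) refl
          where open +-*-Solver

      closed-neighbourhood : ∀ i → ι (δ u i) + e i ≡ 1ℚ ⊎ ι (δ u i) + e i ≡ 0ℚ × u ≢ i × ¬ Graph.Adjacent G u i
      closed-neighbourhood i with u Fin.≟ i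
      ... | yes refl = inj₁ (cong₂ _+_ ι-1 (trans (cong ι (edge-no G (Graph.irreflexive G {i}))) ι-0))
      ... | no u≢i with T? (Graph.adj G u i)
      ...   | yes ui = inj₁ (cong₂ _+_ ι-0 (trans (cong ι (edge-yes G ui)) ι-1))
      ...   | no ¬ui = inj₂ (cong₂ _+_ ι-0 (trans (cong ι (edge-no G ¬ui)) ι-0) , u≢i , ¬ui)

      den : ℚ
      den = ((N - m) - 1ℚ) * D + N * (κ * κ)

      vertex-sum : (8ℚ * (κ * κ)) * X ≤ (8ℚ * (κ * κ)) * (t * t + P) + (4ℚ * ((κ * κ + D) * Q)) * ((N - m) - 1ℚ)
      vertex-sum = subst₂ _≤_ (∑-*ˡ c _) right (∑-mono λ i → weighted-bound i (closed-neighbourhood i))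
        where
        open ≡-Reasoning
        c R : ℚ
        c = 8ℚ * (κ * κ)
        R = 4ℚ * ((κ * κ + D) * Q)
        ∑δ : ∑ (λ i → ι (δ u i)) ≡ 1ℚ
        ∑δ = trans (sym (ι-∑ (δ u))) (trans (cong ι (∑ℕ-δ-one u)) ι-1)
        near : ∑ (λ i → (ι (δ u i) + e i) * (x i * x i)) ≡ t * t + P
        near = begin
          ∑ (λ i → (ι (δ u i) + e i) * (x i * x i))
              ≡⟨ ∑-cong (λ i → ℚ.*-distribʳ-+ (x i * x i) (ι (δ u i)) (e i)) ⟩
          ∑ (λ i → ι (δ u i) * (x i * x i) + e i * (x i * x i)) ≡⟨ ∑-+ _ _ ⟩
          ∑ (λ i → ι (δ u i) * (x i * x i)) + P ≡⟨ cong (_+ P) (∑-δ u (λ i → x i * x i)) ⟩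
          t * t + P ∎
        count : ∑ (λ i → 1ℚ - (ι (δ u i) + e i)) ≡ (N - m) - 1ℚ
        count = begin
          ∑ (λ i → 1ℚ - (ι (δ u i) + e i)) ≡⟨ ∑-- _ _ ⟩
          ∑ {n} (λ _ → 1ℚ) - ∑ (λ i → ι (δ u i) + e i)
              ≡⟨ cong₂ _-_ (∑-one n) (trans (∑-+ _ _) (cong₂ _+_ ∑δ ∑e)) ⟩
          N - (1ℚ + m) ≡⟨ regroup N m ⟩
          (N - m) - 1ℚ ∎
          where
          regroup : ∀ N m → N - (1ℚ + m) ≡ (N - m) - 1ℚ
          regroup = solve 2 (λ N m → N :- (con 1ℚ :+ m) := (N :- m) :- con 1ℚ) refl
            where open +-*-Solver
        right : ∑ (λ i → c * ((ι (δ u i) + e i) * (x i * x i)) + R * (1ℚ - (ι (δ u i) + e i)))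
            ≡ c * (t * t + P) + R * ((N - m) - 1ℚ)
        right = trans (∑-+ _ _) (cong₂ _+_ (trans (∑-*ˡ c _) (cong (c *_) near)) (trans (∑-*ˡ R _) (cong
            (R *_) count)))

      W : ℚ
      W = (m * X - S) + 2ℚ * (t * y)

      Q≡2W : Q ≡ 2ℚ * W
      Q≡2W = trans (cong (_+ 4ℚ * (t * y)) (energy-identity G regular x)) (regroup (m * X) S (t * y))
        where
        regroup : ∀ X S z → (2ℚ * X - 2ℚ * S) + 4ℚ * z ≡ 2ℚ * ((X - S) + 2ℚ * z)
        regroup = solve 3 (λ X S z → (con 2ℚ :* X :- con 2ℚ :* S) :+ con 4ℚ :* z
            := con 2ℚ :* ((X :- S) :+ con 2ℚ :* z)) refl
          where open +-*-Solver

      0≤W : 0ℚ ≤ W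
      0≤W = ℚ.*-cancelˡ-≤-pos 2ℚ (subst₂ _≤_ (sym (ℚ.*-zeroʳ 2ℚ)) Q≡2W 0≤Q)

      -- Adding k² times `star` to `vertex-sum` gives the coefficient k²(4Δ + 3) + 4(k² + D)(n - Δ -
      -- 1), which equals 4d - k² for d = `den`. Passing from Q to W halves the left side.
      weighted : (4ℚ * (κ * κ)) * X ≤ (4ℚ * den - κ * κ) * W
      weighted = ℚ.*-cancelˡ-≤-pos 2ℚ (≤-by d 0≤d (trans (trans (regroup₁ (4ℚ * den
          - κ * κ) W) (cong ((4ℚ * den - κ * κ) *_) (sym Q≡2W))) (identity (κ * κ) X t P N m D Q)))
        where
        d : ℚ
        d = (((8ℚ * (κ * κ)) * (t * t + P) + (4ℚ * ((κ * κ + D) * Q)) * ((N - m) - 1ℚ)) - (8ℚ * (κ * κ)) * X)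
            + (κ * κ) * ((4ℚ * m + 3ℚ) * Q - 8ℚ * (t * t + P))
        0≤d : 0ℚ ≤ d
        0≤d = 0≤+ (≤⇒0≤- vertex-sum) (0≤* (0≤p² κ) (≤⇒0≤- star))
        regroup₁ : ∀ c w → 2ℚ * (c * w) ≡ c * (2ℚ * w)
        regroup₁ = solve 2 (λ c w → con 2ℚ :* (c :* w) := c :* (con 2ℚ :* w)) refl
          where open +-*-Solver
        identity : ∀ c X t P N m D Q → (4ℚ * (((N - m) - 1ℚ) * D + N * c) - c) * Q ≡ 2ℚ * ((4ℚ * c) * X) +
          ((((8ℚ * c) * (t * t + P) + (4ℚ * ((c + D) * Q)) * ((N - m) - 1ℚ)) - (8ℚ * c) * X)
              + c * ((4ℚ * m + 3ℚ) * Q - 8ℚ * (t * t + P)))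
        identity = solve 8 (λ c X t P N m D Q → (con 4ℚ :* (((N :- m) :- con 1ℚ) :* D
            :+ N :* c) :- c) :* Q := con 2ℚ :* ((con 4ℚ :* c) :* X) :+
          ((((con 8ℚ :* c) :* (t :* t :+ P) :+ (con 4ℚ :* ((c
              :+ D) :* Q)) :* ((N :- m) :- con 1ℚ)) :- (con 8ℚ :* c) :* X) :+ c :* ((con 4ℚ :* m
              :+ con 3ℚ) :* Q :- con 8ℚ :* (t :* t :+ P)))) refl
          where open +-*-Solver

      quadratic : ∀ {c} → 0ℚ ≤ c → 0ℚ < den → c * den ≡ κ * κ → (c + ¼ * (c * c)) * X ≤ W
      quadratic {c} 0≤c 0<den c*den = ≤-by d 0≤d (identity c W X)
        where
        instance
          den-positive : Positive den
          den-positive = positive 0<den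
        cancelled : (4ℚ * c) * X ≤ (4ℚ - c) * W
        cancelled = ℚ.*-cancelˡ-≤-pos den (subst₂ _≤_ (trans (cong (λ z → (4ℚ * z) * X) (sym c*den))
            (reg₁ c den X))
          (trans (cong (λ z → (4ℚ * den - z) * W) (sym c*den)) (reg₂ c den W)) weighted)
          where
          reg₁ : ∀ c d X → (4ℚ * (c * d)) * X ≡ d * ((4ℚ * c) * X)
          reg₁ = solve 3 (λ c d X → (con 4ℚ :* (c :* d)) :* X := d :* ((con 4ℚ :* c) :* X)) refl
            where open +-*-Solver
          reg₂ : ∀ c d W → (4ℚ * d - c * d) * W ≡ d * ((4ℚ - c) * W)
          reg₂ = solve 3 (λ c d W → (con 4ℚ :* d :- c :* d) :* W := d :* ((con 4ℚ :- c) :* W)) refl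
            where open +-*-Solver
        slack : ℚ
        slack = (4ℚ - c) * W - (4ℚ * c) * X
        0≤slack : 0ℚ ≤ slack
        0≤slack = ≤⇒0≤- cancelled
        d : ℚ
        -- The quotient 4c/(4 - c), and with it the condition c < 4, is avoided: W = cX + ¼(slack +
        -- cW) by the choice of `slack`, and this equation is substituted once into itself.
        d = ¼ * (slack + c * (¼ * (slack + c * W)))
        0≤d : 0ℚ ≤ d
        0≤d = 0≤* (ℚ.nonNegative⁻¹ ¼) (0≤+ 0≤slack (0≤* 0≤c (0≤* (ℚ.nonNegative⁻¹ ¼) (0≤+ 0≤slack
            (0≤* 0≤c 0≤W)))))
        identity : ∀ c W X → W ≡ (c + ¼ * (c * c)) * X + ¼ * (((4ℚ - c) * W - (4ℚ * c) * X)
            + c * (¼ * (((4ℚ - c) * W - (4ℚ * c) * X) + c * W)))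
        identity = solve 3 (λ c W X → W := (c :+ con ¼ :* (c :* c)) :* X
            :+ con ¼ :* (((con 4ℚ :- c) :* W :- (con 4ℚ :* c) :* X)
            :+ c :* (con ¼ :* (((con 4ℚ :- c) :* W :- (con 4ℚ :* c) :* X) :+ c :* W)))) refl
          where open +-*-Solver

-- From the rational estimate to the denominator of the theorem

module _ (k : ℕ) (1≤k : 1 ℕ.≤ k) (Δ : ℕ) (G : Graph)
         (connected : Connected[ k ] G) (regular : Regular Δ G) where
  open Core k 1≤k Δ G connected regular using (κ; m; N; D)

  -- A second vertex exists because 1 ≤ k < n, and the path to it starts with an edge at `w`. This
  -- supplies a missing edge when H omits the vertex `w`.
  neighbour : ∀ w → ∃ λ w′ → Graph.Adjacent G w w′
  neighbour w = first (proj₂ connected ∅ (subst (ℕ._< k) (sym (Subset.∣⊥∣≡0 (order G))) 1≤k)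
                         w (proj₁ other) Subset.∉⊥ Subset.∉⊥)
    where
    distinct : ∀ {n} → 2 ℕ.≤ n → (w : Fin n) → ∃ λ w′ → w ≢ w′
    distinct (ℕ.s≤s (ℕ.s≤s _)) zero    = suc zero , λ ()
    distinct (ℕ.s≤s (ℕ.s≤s _)) (suc _) = zero , λ ()
    other : ∃ λ w′ → w ≢ w′
    other = distinct (ℕ.≤-trans (ℕ.s≤s 1≤k) (proj₁ connected)) w
    first : Star (AdjacentOutside G ∅) w (proj₁ other) → ∃ λ w′ → Graph.Adjacent G w w′
    first path with proj₁ other | proj₂ other | path
    ... | _ | w≢w | stop = contradiction refl w≢w
    ... | _ | _ | (_ , _ , ww′) ◅ _ = _ , ww′

  Δ<n : Δ ℕ.< order G
  Δ<n = subst₂ ℕ._≤_ eq (∑ℕ-one (order G)) (∑ℕ-mono pointwise)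
    where
    u : Fin (order G)
    u = fromℕ< (ℕ.≤-trans 1≤k (ℕ.<⇒≤ (proj₁ connected)))
    eq : ∑ℕ (λ a → δ u a ℕ.+ edge G u a) ≡ suc Δ
    eq = trans (∑ℕ-+ _ _) (cong₂ ℕ._+_ (∑ℕ-δ-one u) (trans (sym (degree≡∑ G u)) (regular u)))
    pointwise : ∀ a → δ u a ℕ.+ edge G u a ℕ.≤ 1
    pointwise a with u Fin.≟ a
    ... | yes refl = ℕ.≤-reflexive (cong suc (edge-no G (Graph.irreflexive G {a})))
    ... | no _ with Graph.adj G u a
    ...   | true  = ℕ.≤-refl
    ...   | false = ℕ.z≤n

  -- With n = 1 + Δ + r and k replaced by its successor form, the truncated subtractions disappear
  -- and both sides are polynomials.
  ι-denominator : ι (denominator (order G) Δ k) ≡ ((N - m) - 1ℚ) * D + N * (κ * κ)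
  ι-denominator = general k 1≤k (order G) Δ<n
    where
    general : ∀ k → 1 ℕ.≤ k → ∀ n → Δ ℕ.< n →
      ι (denominator n Δ k) ≡ ((ι n - ι Δ) - 1ℚ) * (((ι n - ι Δ) + 2ℚ * ι k) - 2ℚ) + ι n * (ι k * ι k)
    general (suc k) _ n Δ<n with ℕ.m≤n⇒∃[o]m+o≡n Δ<n
    ... | r , refl = begin
      ι (denominator (suc Δ ℕ.+ r) Δ (suc k)) ≡⟨ cong ι natural ⟩
      ι (r ℕ.* (1 ℕ.+ r ℕ.+ 2 ℕ.* k) ℕ.+ (1 ℕ.+ Δ ℕ.+ r) ℕ.* ((1 ℕ.+ k) ℕ.* (1 ℕ.+ k))) ≡⟨ casts ⟩
      ι r * (ι 1 + ι r + ι 2 * ι k) + (ι 1 + ι Δ + ι r) * ((ι 1 + ι k) * (ι 1 + ι k))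
        ≡⟨ cong₂ (λ p q → ι r * (p + ι r + q * ι k) + (p + ι Δ + ι r) * ((p + ι k) * (p + ι k))) ι-1 ι-2 ⟩
      ι r * (1ℚ + ι r + 2ℚ * ι k) + (1ℚ + ι Δ + ι r) * ((1ℚ + ι k) * (1ℚ + ι k))
        ≡⟨ identity (ι r) (ι k) (ι Δ) ⟩
      expression (1ℚ + ι Δ + ι r) (1ℚ + ι k)
        ≡⟨ cong₂ expression (trans (ι-+ (1 ℕ.+ Δ) r) (cong (_+ ι r) (suc-cast Δ))) (suc-cast k) ⟨
      expression (ι (suc Δ ℕ.+ r)) (ι (suc k)) ∎
      where
      open ≡-Reasoning
      expression : ℚ → ℚ → ℚ
      expression n k = ((n - ι Δ) - 1ℚ) * (((n - ι Δ) + 2ℚ * k) - 2ℚ) + n * (k * k)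
      suc-cast : ∀ j → ι (suc j) ≡ 1ℚ + ι j
      suc-cast j = trans (ι-+ 1 j) (cong (_+ ι j) ι-1)
      natural : denominator (suc Δ ℕ.+ r) Δ (suc k)
              ≡ r ℕ.* (1 ℕ.+ r ℕ.+ 2 ℕ.* k) ℕ.+ (1 ℕ.+ Δ ℕ.+ r) ℕ.* ((1 ℕ.+ k) ℕ.* (1 ℕ.+ k))
      natural = cong₂ ℕ._+_ (cong₂ ℕ._*_ gap₁ gap₂) (cong (λ j → (suc Δ ℕ.+ r) ℕ.* (suc k ℕ.* j))
          (ℕ.*-identityʳ (suc k)))
        where
        gap : suc Δ ℕ.+ r ℕ.∸ Δ ≡ suc r
        gap = trans (cong (ℕ._∸ Δ) (sym (ℕ.+-suc Δ r))) (ℕ.m+n∸m≡n Δ (suc r))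
        gap₁ : suc Δ ℕ.+ r ℕ.∸ Δ ℕ.∸ 1 ≡ r
        gap₁ = cong (ℕ._∸ 1) gap
        gap₂ : suc Δ ℕ.+ r ℕ.∸ Δ ℕ.+ 2 ℕ.* suc k ℕ.∸ 2 ≡ 1 ℕ.+ r ℕ.+ 2 ℕ.* k
        gap₂ = trans (cong₂ (λ p q → p ℕ.+ q ℕ.∸ 2) gap (ℕ.*-suc 2 k))
                 (trans (cong (ℕ._∸ 2) (trans (sym (ℕ.+-assoc (suc r) 2 (2 ℕ.* k))) (cong (ℕ._+ 2 ℕ.* k)
                     (ℕ.+-comm (suc r) 2)))) refl)
      casts : ι (r ℕ.* (1 ℕ.+ r ℕ.+ 2 ℕ.* k) ℕ.+ (1 ℕ.+ Δ ℕ.+ r) ℕ.* ((1 ℕ.+ k) ℕ.* (1 ℕ.+ k)))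
            ≡ ι r * (ι 1 + ι r + ι 2 * ι k) + (ι 1 + ι Δ + ι r) * ((ι 1 + ι k) * (ι 1 + ι k))
      casts = trans (ι-+ (r ℕ.* (1 ℕ.+ r ℕ.+ 2 ℕ.* k)) _) (cong₂ _+_
        (trans (ι-* r _) (cong (ι r *_) (trans (ι-+ (1 ℕ.+ r) _) (cong₂ _+_ (ι-+ 1 r) (ι-* 2 k)))))
        (trans (ι-* (1 ℕ.+ Δ ℕ.+ r) _) (cong₂ _*_ (trans (ι-+ (1 ℕ.+ Δ) r) (cong (_+ ι r) (ι-+ 1 Δ)))
          (trans (ι-* (1 ℕ.+ k) (1 ℕ.+ k)) (cong₂ _*_ (ι-+ 1 k) (ι-+ 1 k))))))
      identity : ∀ r k d → r * (1ℚ + r + 2ℚ * k) + (1ℚ + d + r) * ((1ℚ + k) * (1ℚ + k))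
        ≡ ((1ℚ + d + r - d) - 1ℚ) * (((1ℚ + d + r - d) + 2ℚ * (1ℚ + k)) - 2ℚ) + (1ℚ + d + r) * ((1ℚ
            + k) * (1ℚ + k))
      identity = solve 3 (λ r k d → r :* (con 1ℚ :+ r :+ con 2ℚ :* k) :+ (con 1ℚ :+ d :+ r) :* ((con 1ℚ
          :+ k) :* (con 1ℚ :+ k))
        := ((con 1ℚ :+ d :+ r :- d) :- con 1ℚ) :* (((con 1ℚ :+ d :+ r :- d) :+ con 2ℚ :* (con 1ℚ
            :+ k)) :- con 2ℚ) :+ (con 1ℚ :+ d :+ r) :* ((con 1ℚ :+ k) :* (con 1ℚ :+ k))) refl
        where open +-*-Solver

  -- The two ends of the edge play symmetric roles, so the end with the smaller value can be taken
  -- as `u` in `Core`.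
  quadratic-form : ∀ {c} → 0ℚ ≤ c → c * ι (denominator (order G) Δ k) ≡ κ * κ →
    0ℚ < ι (denominator (order G) Δ k) →
    ∀ u v → Graph.Adjacent G u v → ∀ x → (∀ a → 0ℚ ≤ x a) →
    (c + ¼ * (c * c)) * ∑ (λ a → x a * x a)
      ≤ (m * ∑ (λ a → x a * x a) - adjacency-form G x) + 2ℚ * (x u * x v)
  quadratic-form {c} 0≤c c*den 0<den u v uv x 0≤x = [ at u v uv , (λ v≤u →
      subst (λ z → (c + ¼ * (c * c)) * X ≤ (m * X - adjacency-form G x) + 2ℚ * z) (ℚ.*-comm (x v) (x u))
        (at v u (Graph.symmetric G uv) v≤u)) ]′ (ℚ.≤-total (x u) (x v))
    where
    X : ℚ
    X = ∑ (λ a → x a * x a)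
    at : ∀ u v → Graph.Adjacent G u v → x u ≤ x v →
         (c + ¼ * (c * c)) * X ≤ (m * X - adjacency-form G x) + 2ℚ * (x u * x v)
    at u v uv u≤v = Core.quadratic k 1≤k Δ G connected regular u v uv x 0≤x u≤v 0≤c
      (subst (0ℚ <_) ι-denominator 0<den) (trans (cong (c *_) (sym ι-denominator)) c*den)

opaque
  unfolding ι

  fraction-* : ∀ a d .{{_ : NonZero d}} → (ℤ.+ a / d) * ι d ≡ ι a
  fraction-* a (suc d) = ℚ.toℚᵘ-injective (begin
    toℚᵘ ((ℤ.+ a / suc d) * ι (suc d))            ≈⟨ ℚ.toℚᵘ-homo-* (ℤ.+ a / suc d) (ι (suc d)) ⟩
    toℚᵘ (ℤ.+ a / suc d) ℚᵘ.* toℚᵘ (ι (suc d))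
      ≈⟨ ℚᵘ.*-cong (ℚ.toℚᵘ-fromℚᵘ (ℚᵘ.mkℚᵘ (ℤ.+ a) d)) (ℚ.toℚᵘ-fromℚᵘ (ℚᵘ.mkℚᵘ (ℤ.+ suc d) 0)) ⟩
    ℚᵘ.mkℚᵘ (ℤ.+ a) d ℚᵘ.* ℚᵘ.mkℚᵘ (ℤ.+ suc d) 0
      ≈⟨ ℚᵘ.*≡* (trans (ℤ.*-identityʳ _) (cong (λ z → ℤ.+ a ℤ.* ℤ.+ z) (sym (ℕ.*-identityʳ (suc d))))) ⟩
    ℚᵘ.mkℚᵘ (ℤ.+ a) 0                             ≈⟨ ℚ.toℚᵘ-fromℚᵘ (ℚᵘ.mkℚᵘ (ℤ.+ a) 0) ⟨
    toℚᵘ (ι a)                                    ∎)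
    where open ℚᵘ.≃-Reasoning

  fromℕ≡ι : ∀ n m → seq (fromℕ n) m ≡ ι n
  fromℕ≡ι n m = refl

-- Vectors on subgraphs

p≤∣p∣ : ∀ p → p ≤ ∣ p ∣
p≤∣p∣ p with ℚ.≤-total 0ℚ p
... | inj₁ 0≤p = ℚ.≤-reflexive (sym (ℚ.0≤p⇒∣p∣≡p 0≤p))
... | inj₂ p≤0 = ℚ.≤-trans p≤0 (ℚ.0≤∣p∣ p)

∣p∣²≡p² : ∀ p → ∣ p ∣ * ∣ p ∣ ≡ p * p
∣p∣²≡p² p = trans (sym (ℚ.∣p*q∣≡∣p∣*∣q∣ p p)) (ℚ.0≤p⇒∣p∣≡p (0≤p² p))

module Pushforward {G : Graph} (H : Subgraph G) where
  open Subgraph H using (graph; injective; edges) renaming (ι to φ)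

  Missing : Fin (order G) → Fin (order G) → Set
  Missing u v = Graph.Adjacent G u v × (∀ a b → Graph.Adjacent graph a b → ¬ (φ a ≡ u × φ b ≡ v))

  -- If H omits a vertex, any edge at that vertex is missing. If H is spanning, properness and a
  -- finite search give a nonadjacent pair of H with adjacent images.
  missing-edge : (∀ w → ∃ λ w′ → Graph.Adjacent G w w′) → IsProper H → ∃ λ u → ∃ λ v → Missing u v
  missing-edge neighbour proper with Fin.all? (λ w → Fin.any? λ a → φ a Fin.≟ w)
  ... | no ¬onto with Fin.¬∀⟶∃¬ _ _ (λ w → Fin.any? λ a → φ a Fin.≟ w) ¬onto
  ...   | w , w∉ = w , proj₁ (neighbour w) , proj₂ (neighbour w) , λ a _ _ (φa≡w , _) → w∉ (a , φa≡w)
  missing-edge neighbour proper | yes onto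
    with Fin.any? (λ a → Fin.any? λ b → T? (Graph.adj G (φ a) (φ b)) ×-dec ¬? (T? (Graph.adj graph a b)))
  ... | yes (a , b , ab , ¬ab) = φ a , φ b , ab , λ a′ b′ ab′ (φa′ , φb′) →
          ¬ab (subst₂ (Graph.Adjacent graph) (injective φa′) (injective φb′) ab′)
  ... | no none = contradiction (onto , λ {a} {b} ab →
          decidable-stable (T? (Graph.adj graph a b)) λ ¬ab → none (a , b , ab , ¬ab)) proper

  module _ {u v} (missing : Missing u v) where

    u≢v : u ≢ v
    u≢v refl = Graph.irreflexive G (proj₁ missing)

    -- The δ terms are the two matrix entries of the missing edge. They cannot both be 1, as u ≠ v,
    -- and where one of them is 1 the pair is not an edge of H.
    edge-excess : ∀ a b →
      edge graph a b ℕ.+ (δ u (φ a) ℕ.* δ v (φ b) ℕ.+ δ v (φ a) ℕ.* δ u (φ b)) ℕ.≤ edge G (φ a) (φ b)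
    edge-excess a b with T? (Graph.adj graph a b)
    ... | no ¬ab rewrite edge-no graph ¬ab with u Fin.≟ φ a | v Fin.≟ φ b | v Fin.≟ φ a | u Fin.≟ φ b
    ...   | yes p | yes q | yes r | _     = contradiction (trans p (sym r)) u≢v
    ...   | yes p | yes q | no _  | _     = ℕ.≤-reflexive (sym (edge-yes G (subst₂ (Graph.Adjacent G) p q
        (proj₁ missing))))
    ...   | yes p | no _  | yes r | _     = contradiction (trans p (sym r)) u≢v
    ...   | yes p | no _  | no _  | _     = ℕ.z≤n
    ...   | no _  | _     | yes r | yes s = ℕ.≤-reflexive (sym (edge-yes G (subst₂ (Graph.Adjacent G) r s
        (Graph.symmetric G (proj₁ missing)))))
    ...   | no _  | _     | yes r | no _  = ℕ.z≤n
    ...   | no _  | _     | no _  | _     = ℕ.z≤n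
    edge-excess a b | yes ab rewrite edge-yes graph ab | edge-yes G (edges ab)
      with u Fin.≟ φ a | v Fin.≟ φ b | v Fin.≟ φ a | u Fin.≟ φ b
    ...   | yes p | yes q | _     | _     = contradiction (sym p , sym q) (proj₂ missing a b ab)
    ...   | _     | _     | yes r | yes s = contradiction (sym s , sym r) (proj₂ missing b a
        (Graph.symmetric graph ab))
    ...   | yes _ | no _  | yes _ | no _  = ℕ.≤-refl
    ...   | yes _ | no _  | no _  | _     = ℕ.≤-refl
    ...   | no _  | _     | yes _ | no _  = ℕ.≤-refl
    ...   | no _  | _     | no _  | _     = ℕ.≤-refl

  module _ (z : Fin (order graph) → ℚ) where

    -- Extension by zero along `φ`. As a sum it needs no inverse of `φ`, and a change of variables
    -- becomes an exchange of sums.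
    push : Fin (order G) → ℚ
    push w = ∑ λ a → ι (δ (φ a) w) * z a

    push-∑ : ∀ (f : Fin (order G) → ℚ) → ∑ (λ a → f (φ a) * z a) ≡ ∑ (λ w → f w * push w)
    push-∑ f = begin
      ∑ (λ a → f (φ a) * z a) ≡⟨ ∑-cong (λ a → ∑-δ (φ a) (λ w → f w * z a)) ⟨
      ∑∑ (λ a w → ι (δ (φ a) w) * (f w * z a)) ≡⟨ ∑-comm _ ⟩
      ∑∑ (λ w a → ι (δ (φ a) w) * (f w * z a)) ≡⟨ ∑∑-cong (λ w a → regroup (ι (δ (φ a) w)) (f w) (z a)) ⟩
      ∑∑ (λ w a → f w * (ι (δ (φ a) w) * z a)) ≡⟨ ∑-cong (λ w → ∑-*ˡ (f w) _) ⟩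
      ∑ (λ w → f w * push w) ∎
      where
      open ≡-Reasoning
      regroup : ∀ d f z → d * (f * z) ≡ f * (d * z)
      regroup = solve 3 (λ d f z → d :* (f :* z) := f :* (d :* z)) refl
        where open +-*-Solver

    push-∑∑ : ∀ (f : Fin (order G) → Fin (order G) → ℚ) →
        ∑∑ (λ a b → f (φ a) (φ b) * (z a * z b)) ≡ ∑∑ (λ w w′ → f w w′ * (push w * push w′))
    push-∑∑ f = begin
      ∑∑ (λ a b → f (φ a) (φ b) * (z a * z b)) ≡⟨ ∑-cong (λ a → inner (λ b → f (φ a) (φ b)) z (z a)) ⟩
      ∑ (λ a → ∑ (λ b → f (φ a) (φ b) * z b) * z a) ≡⟨ ∑-cong (λ a → cong (_* z a) (push-∑ (f (φ a)))) ⟩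
      ∑ (λ a → ∑ (λ w′ → f (φ a) w′ * push w′) * z a) ≡⟨ push-∑ (λ w → ∑ (λ w′ → f w w′ * push w′)) ⟩
      ∑ (λ w → ∑ (λ w′ → f w w′ * push w′) * push w) ≡⟨ ∑-cong (λ w → inner (f w) push (push w)) ⟨
      ∑∑ (λ w w′ → f w w′ * (push w * push w′)) ∎
      where
      open ≡-Reasoning
      inner : ∀ {n} (g q : Fin n → ℚ) p → ∑ (λ b → g b * (p * q b)) ≡ ∑ (λ b → g b * q b) * p
      inner g q p = trans (∑-cong λ b → regroup (g b) p (q b)) (∑-*ʳ (λ b → g b * q b) p)
        where
        regroup : ∀ g p q → g * (p * q) ≡ (g * q) * p
        regroup = solve 3 (λ g p q → g :* (p :* q) := (g :* q) :* p) refl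
          where open +-*-Solver

    push-φ : ∀ a → push (φ a) ≡ z a
    push-φ a = trans (∑-cong λ b → cong (λ d → ι d * z b) (reflect b)) (∑-δ a z)
      where
      reflect : ∀ b → δ (φ b) (φ a) ≡ δ a b
      reflect b with a Fin.≟ b
      ... | yes refl = δ-refl (φ b)
      ... | no a≢b   = δ-≢ λ eq → a≢b (sym (injective eq))

    push-² : ∑ (λ w → push w * push w) ≡ ∑ (λ a → z a * z a)
    push-² = trans (sym (push-∑ push)) (∑-cong λ a → cong (_* z a) (push-φ a))

    push-pair : ∀ u v → ∑∑ (λ a b → ι (δ u (φ a) ℕ.* δ v (φ b)) * (z a * z b)) ≡ push u * push v
    push-pair u v = begin
      ∑∑ (λ a b → ι (δ u (φ a) ℕ.* δ v (φ b)) * (z a * z b)) ≡⟨ push-∑∑ (λ w w′ → ι (δ u w ℕ.* δ v w′)) ⟩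
      ∑∑ (λ w w′ → ι (δ u w ℕ.* δ v w′) * (push w * push w′))
        ≡⟨ ∑∑-cong (λ w w′ → trans (cong (_* (push w * push w′)) (ι-* (δ u w) (δ v w′)))
                                    (regroup (ι (δ u w)) (ι (δ v w′)) (push w) (push w′))) ⟩
      ∑∑ (λ w w′ → ι (δ u w) * (ι (δ v w′) * (push w * push w′)))
        ≡⟨ ∑-cong (λ w → trans (∑-*ˡ (ι (δ u w)) _) (cong (ι (δ u w) *_) (∑-δ v (λ w′ → push w * push w′)))) ⟩
      ∑ (λ w → ι (δ u w) * (push w * push v)) ≡⟨ ∑-δ u (λ w → push w * push v) ⟩
      push u * push v ∎
      where
      open ≡-Reasoning
      regroup : ∀ d e p q → (d * e) * (p * q) ≡ d * (e * (p * q))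
      regroup = solve 4 (λ d e p q → (d :* e) :* (p :* q) := d :* (e :* (p :* q))) refl
        where open +-*-Solver

    0≤push : (∀ a → 0ℚ ≤ z a) → ∀ w → 0ℚ ≤ push w
    0≤push 0≤z w = 0≤∑ λ a → 0≤* (0≤ι _) (0≤z a)

  -- Absolute values only raise the form, because the matrix entries are nonnegative, and they
  -- produce the nonnegative vector that `quadratic-form` asks for. The rest is `edge-excess` summed
  -- over all pairs.
  restricted-form : ∀ {u v} → Missing u v → ∀ y → let x = push (λ a → ∣ y a ∣) in
    adjacency-form graph y + 2ℚ * (x u * x v) ≤ adjacency-form G x
  restricted-form {u} {v} missing y = begin
    adjacency-form graph y + 2ℚ * (x u * x v) ≡⟨ cong (adjacency-form graph y +_) (split (x u) (x v)) ⟩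
    adjacency-form graph y + (x u * x v + x v * x u)
      ≤⟨ ℚ.+-monoˡ-≤ _ (∑∑-mono λ a b → ℚ.*-monoˡ-≤-nonNeg (A[ graph ] a b) {{nonNegative (0≤ι _)}}
           (subst (y a * y b ≤_) (ℚ.∣p*q∣≡∣p∣*∣q∣ (y a) (y b)) (p≤∣p∣ (y a * y b)))) ⟩
    adjacency-form graph z + (x u * x v + x v * x u)
      ≡⟨ cong (adjacency-form graph z +_) (cong₂ _+_ (push-pair z u v) (push-pair z v u)) ⟨
    adjacency-form graph z + (∑∑ (λ a b → pair u v a b * (z a * z b)) + ∑∑ (λ a b → pair v u a b * (z a * z b)))
      ≡⟨ trans (∑∑-+ _ _) (cong (adjacency-form graph z +_) (∑∑-+ _ _)) ⟨
    ∑∑ (λ a b → A[ graph ] a b * (z a * z b) + (pair u v a b * (z a * z b) + pair v u a b * (z a * z b)))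
      ≤⟨ ∑∑-mono pointwise ⟩
    ∑∑ (λ a b → A[ G ] (φ a) (φ b) * (z a * z b)) ≡⟨ push-∑∑ z A[ G ] ⟩
    adjacency-form G x ∎
    where
    open ℚ.≤-Reasoning
    z : Fin (order graph) → ℚ
    z a = ∣ y a ∣
    x : Fin (order G) → ℚ
    x = push z
    pair : Fin (order G) → Fin (order G) → Fin (order graph) → Fin (order graph) → ℚ
    pair u v a b = ι (δ u (φ a) ℕ.* δ v (φ b))
    split : ∀ p q → 2ℚ * (p * q) ≡ p * q + q * p
    split = solve 2 (λ p q → con 2ℚ :* (p :* q) := p :* q :+ q :* p) refl
      where open +-*-Solver
    pointwise : ∀ a b → A[ graph ] a b * (z a * z b) + (pair u v a b * (z a * z b) + pair v u a b * (z a * z b))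
                      ≤ A[ G ] (φ a) (φ b) * (z a * z b)
    pointwise a b = subst (_≤ A[ G ] (φ a) (φ b) * (z a * z b)) eq
      (ℚ.*-monoʳ-≤-nonNeg (z a * z b) {{nonNegative (0≤* (ℚ.0≤∣p∣ (y a)) (ℚ.0≤∣p∣ (y b)))}}
        (ι-mono (edge-excess missing a b)))
      where
      collect : ∀ p q r z → (p + (q + r)) * z ≡ p * z + (q * z + r * z)
      collect = solve 4 (λ p q r z → (p :+ (q :+ r)) :* z := p :* z :+ (q :* z :+ r :* z)) refl
        where open +-*-Solver
      eq : ι (edge graph a b ℕ.+ (δ u (φ a) ℕ.* δ v (φ b) ℕ.+ δ v (φ a) ℕ.* δ u (φ b))) * (z a * z b)
         ≡ A[ graph ] a b * (z a * z b) + (pair u v a b * (z a * z b) + pair v u a b * (z a * z b))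
      eq = trans (cong (_* (z a * z b)) (trans (ι-+ (edge graph a b) _) (cong (A[ graph ] a b +_) (ι-+ _ _))))
             (collect (A[ graph ] a b) (pair u v a b) (pair v u a b) (z a * z b))

-- The term 2x_u x_v gained in `restricted-form` cancels the one in `quadratic-form`, and `push`
-- preserves the sum of squares.
subgraph-form : ∀ k → 1 ℕ.≤ k → ∀ Δ G → Connected[ k ] G → Regular Δ G →
  (H : Subgraph G) → IsProper H →
  ∀ {c} → 0ℚ ≤ c → c * ι (denominator (order G) Δ k) ≡ ι k * ι k →
  0ℚ < ι (denominator (order G) Δ k) → ∀ y →
  adjacency-form (Subgraph.graph H) y ≤ (ι Δ - (c + ¼ * (c * c))) * ∑ (λ a → y a * y a)
subgraph-form k 1≤k Δ G connected regular H proper {c} 0≤c c*den 0<den y =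
  conclude (missing-edge (neighbour k 1≤k Δ G connected regular) proper)
  where
  open Pushforward H
  z : Fin (order (Subgraph.graph H)) → ℚ
  z a = ∣ y a ∣
  x : Fin (order G) → ℚ
  x = push z
  γ X Y : ℚ
  γ = c + ¼ * (c * c)
  X = ∑ (λ a → x a * x a)
  Y = ∑ (λ a → y a * y a)
  X≡Y : X ≡ Y
  X≡Y = trans (push-² z) (∑-cong λ a → ∣p∣²≡p² (y a))
  conclude : (∃ λ u → ∃ λ v → Missing u v) → adjacency-form (Subgraph.graph H) y ≤ (ι Δ - γ) * Y
  conclude (u , v , missing) = ≤-by d 0≤d (trans (cong ((ι Δ - γ) *_) (sym X≡Y))
                                 (identity (ι Δ) γ X S (x u * x v) (adjacency-form (Subgraph.graph H) y)))
    where
    S d : ℚ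
    S = adjacency-form G x
    d = (((ι Δ * X - S) + 2ℚ * (x u * x v)) - γ * X) + (S - (adjacency-form (Subgraph.graph H) y
        + 2ℚ * (x u * x v)))
    0≤d : 0ℚ ≤ d
    0≤d = 0≤+ (≤⇒0≤- (quadratic-form k 1≤k Δ G connected regular 0≤c c*den 0<den u v (proj₁ missing) x
        (0≤push z λ a → ℚ.0≤∣p∣ (y a))))
              (≤⇒0≤- (restricted-form missing y))
    identity : ∀ m γ X S w F → (m - γ) * X ≡ F + ((((m * X - S) + 2ℚ * w) - γ * X) + (S - (F + 2ℚ * w)))
    identity = solve 6 (λ m γ X S w F → (m :- γ) :* X
        := F :+ ((((m :* X :- S) :+ con 2ℚ :* w) :- γ :* X) :+ (S :- (F :+ con 2ℚ :* w)))) refl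
      where open +-*-Solver

-- Real eigenvalues

Eventually : (ℕ → Set) → Set
Eventually P = ∃ λ N → ∀ m → N ℕ.≤ m → P m

eventually-all : ∀ {n} {P : Fin n → ℕ → Set} → (∀ i → Eventually (P i)) → Eventually (λ m → ∀ i → P i m)
eventually-all {zero}  ev = 0 , λ _ _ ()
eventually-all {suc n} {P} ev with ev zero | eventually-all {P = P ∘ suc} (ev ∘ suc)
... | M , p | N , q = M ℕ.⊔ N , λ m ≤m →
  λ { zero → p m (ℕ.m⊔n≤o⇒m≤o M N ≤m) ; (suc i) → q m (ℕ.m⊔n≤o⇒n≤o M N ≤m) i }

opaque
  unfolding ∑ ι

  seq-sum : ∀ {n} (f : Fin n → ℝ) m → seq (sum f) m ≡ ∑ (λ i → seq (f i) m)
  seq-sum {zero}  f m = refl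
  seq-sum {suc n} f m = cong (seq (f zero) m +_) (seq-sum (f ∘ suc) m)

  seq-adjacency : ∀ G a b m → seq (Graph.adjacencyMatrix G a b) m ≡ A[ G ] a b
  seq-adjacency G a b m with Graph.adj G a b
  ... | true  = refl
  ... | false = refl

seq-· : ∀ G (v : Fin (order G) → ℝ) a m →
  seq ((Graph.adjacencyMatrix G · v) a) m ≡ ∑ (λ b → A[ G ] a b * seq (v b) m)
seq-· G v a m = trans (seq-sum _ m) (∑-cong λ b → cong (_* seq (v b) m) (seq-adjacency G a b m))

-- `ρ` is the accuracy asked of the eigenvector equation. The choice ηε/(n + 1) avoids a square
-- root, since nρ² < (n + 1)²ρ².
small-square : ∀ {η ε} → 0ℚ < η → 0ℚ < ε → ∀ n →
  ∃ λ ρ → 0ℚ < ρ × ι n * (ρ * ρ) < (η * ε) * (η * ε)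
small-square {η} {ε} 0<η 0<ε n = ρ , 0<ρ , (begin-strict
  ι n * (ρ * ρ)               ≡⟨ ℚ.+-identityʳ _ ⟨
  ι n * (ρ * ρ) + 0ℚ          <⟨ ℚ.+-monoʳ-< (ι n * (ρ * ρ)) 0<rest ⟩
  ι n * (ρ * ρ) + rest        ≡⟨ identity (ι n) ρ ⟩
  (K′ * ρ) * (K′ * ρ)         ≡⟨ cong (λ k → (k * ρ) * (k * ρ)) K≡ ⟨
  (K * ρ) * (K * ρ)           ≡⟨ cong₂ _*_ Kρ Kρ ⟩
  (η * ε) * (η * ε)           ∎)
  where
  open ℚ.≤-Reasoning
  K K′ ρ rest : ℚ
  K = ι (suc n)
  K′ = 1ℚ + ι n
  K≡ : K ≡ K′
  K≡ = trans (ι-+ 1 n) (cong (_+ ι n) ι-1)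
  instance
    K-positive : Positive K
    K-positive = positive (0<ι (ℕ.s≤s ℕ.z≤n))
    K-nonZero : ℚ.NonZero K
    K-nonZero = ℚ.pos⇒nonZero K
    ηε-positive : Positive (η * ε)
    ηε-positive = ℚ.pos*pos⇒pos η {{positive 0<η}} ε {{positive 0<ε}}
  ρ = 1/ K * (η * ε)
  ρ-positive : Positive ρ
  ρ-positive = ℚ.pos*pos⇒pos (1/ K) {{ℚ.1/pos⇒pos K}} (η * ε)
  0<ρ : 0ℚ < ρ
  0<ρ = ℚ.positive⁻¹ ρ {{ρ-positive}}
  Kρ : K * ρ ≡ η * ε
  Kρ = trans (sym (ℚ.*-assoc K (1/ K) (η * ε)))
         (trans (cong (_* (η * ε)) (ℚ.*-inverseʳ K)) (ℚ.*-identityˡ (η * ε)))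
  rest = ρ * ρ + (ι n + ι n * ι n) * (ρ * ρ)
  0<rest : 0ℚ < rest
  0<rest = ℚ.+-mono-<-≤ (ℚ.positive⁻¹ (ρ * ρ) {{ℚ.pos*pos⇒pos ρ {{ρ-positive}} ρ {{ρ-positive}}}})
             (0≤* (0≤+ (0≤ι n) (0≤p² (ι n))) (0≤p² ρ))
  identity : ∀ n ρ → n * (ρ * ρ) + (ρ * ρ + (n + n * n) * (ρ * ρ)) ≡ ((1ℚ + n) * ρ) * ((1ℚ + n) * ρ)
  identity = solve 2 (λ n ρ → n :* (ρ :* ρ) :+ (ρ :* ρ :+ (n :+ n :* n) :* (ρ :* ρ))
      := ((con 1ℚ :+ n) :* ρ) :* ((con 1ℚ :+ n) :* ρ)) refl
    where open +-*-Solver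

entry≤∑ : ∀ {n} {f : Fin n → ℚ} → (∀ i → 0ℚ ≤ f i) → ∀ i → f i ≤ ∑ f
entry≤∑ {f = f} 0≤f i = subst (_≤ ∑ f) (∑-δ i f) (∑-mono pointwise)
  where
  pointwise : ∀ j → ι (δ i j) * f j ≤ f j
  pointwise j with i Fin.≟ j
  ... | yes refl rewrite ι-1 = ℚ.≤-reflexive (ℚ.*-identityˡ (f i))
  ... | no _     rewrite ι-0 = subst (_≤ f j) (sym (ℚ.*-zeroˡ (f j))) (0≤f j)

∑-const : ∀ n c → ∑ {n} (λ _ → c) ≡ ι n * c
∑-const n c = trans (∑-cong {n} (λ _ → sym (ℚ.*-identityˡ c))) (trans (∑-*ʳ {n} (λ _ → 1ℚ) c) (cong (_* c)
    (∑-one n)))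

-- Expand 0 ≤ ∑ (r a + η y a)², where ∑ r a y a = yᵀAy − μ ∑ (y a)².
residual-bound : ∀ G {β η μ} → (∀ y → adjacency-form G y ≤ β * ∑ (λ a → y a * y a)) →
  0ℚ < η → β + η ≤ μ → ∀ y →
  let r = λ a → ∑ (λ b → A[ G ] a b * y b) - μ * y a in
  (η * η) * ∑ (λ a → y a * y a) ≤ ∑ (λ a → r a * r a)
residual-bound G {β} {η} {μ} rayleigh 0<η β+η≤μ y = ≤-by d 0≤d (begin
    R ≡⟨ identity R (η * η) η X F μ β ⟩
    (η * η) * X + ((R + (2ℚ * η) * (F - μ * X) + (η * η) * X) + (2ℚ * η) * ((β * X - F) + (μ - (β + η)) * X))
      ≡⟨ cong (λ z → (η * η) * X + (z + (2ℚ * η) * ((β * X - F) + (μ - (β + η)) * X))) squares ⟨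
    (η * η) * X + d ∎)
  where
  open ≡-Reasoning
  r : Fin (order G) → ℚ
  r a = ∑ (λ b → A[ G ] a b * y b) - μ * y a
  X R F d : ℚ
  X = ∑ (λ a → y a * y a)
  R = ∑ (λ a → r a * r a)
  F = adjacency-form G y
  -- Because F - μX ≤ -ηX, the cross term of the expanded square is at most -2η²X, which leaves R ≥
  -- η²X.
  d = ∑ (λ a → (r a + η * y a) * (r a + η * y a)) + (2ℚ * η) * ((β * X - F) + (μ - (β + η)) * X)
  0≤d : 0ℚ ≤ d
  0≤d = 0≤+ (0≤∑ λ a → 0≤p² (r a + η * y a))
    (0≤* (0≤* 0≤2ℚ (ℚ.<⇒≤ 0<η)) (0≤+ (≤⇒0≤- (rayleigh y)) (0≤* (≤⇒0≤- β+η≤μ) (0≤∑ λ a → 0≤p² (y a)))))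
  pairing : ∑ (λ a → r a * y a) ≡ F - μ * X
  pairing = begin
    ∑ (λ a → r a * y a) ≡⟨ ∑-cong (λ a → distrib (∑ (λ b → A[ G ] a b * y b)) μ (y a)) ⟩
    ∑ (λ a → ∑ (λ b → A[ G ] a b * y b) * y a - μ * (y a * y a)) ≡⟨ ∑-- _ _ ⟩
    ∑ (λ a → ∑ (λ b → A[ G ] a b * y b) * y a) - ∑ (λ a → μ * (y a * y a))
      ≡⟨ cong₂ _-_ (∑-cong λ a → trans (sym (∑-*ʳ (λ b → A[ G ] a b * y b) (y a))) (∑-cong λ b → swap
          (A[ G ] a b) (y b) (y a)))
                   (∑-*ˡ μ _) ⟩
    F - μ * X ∎
    where
    distrib : ∀ s μ y → (s - μ * y) * y ≡ s * y - μ * (y * y)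
    distrib = solve 3 (λ s μ y → (s :- μ :* y) :* y := s :* y :- μ :* (y :* y)) refl
      where open +-*-Solver
    swap : ∀ a p q → (a * p) * q ≡ a * (q * p)
    swap = solve 3 (λ a p q → (a :* p) :* q := a :* (q :* p)) refl
      where open +-*-Solver
  squares : ∑ (λ a → (r a + η * y a) * (r a + η * y a)) ≡ R + (2ℚ * η) * (F - μ * X) + (η * η) * X
  squares = begin
    ∑ (λ a → (r a + η * y a) * (r a + η * y a)) ≡⟨ ∑-cong (λ a → expand (r a) η (y a)) ⟩
    ∑ (λ a → (r a * r a + (2ℚ * η) * (r a * y a)) + (η * η) * (y a * y a))
        ≡⟨ trans (∑-+ _ _) (cong (_+ _) (∑-+ _ _)) ⟩
    R + ∑ (λ a → (2ℚ * η) * (r a * y a)) + ∑ (λ a → (η * η) * (y a * y a))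
      ≡⟨ cong₂ (λ p q → R + p + q) (trans (∑-*ˡ (2ℚ * η) _) (cong ((2ℚ * η) *_) pairing)) (∑-*ˡ (η * η) _) ⟩
    R + (2ℚ * η) * (F - μ * X) + (η * η) * X ∎
    where
    expand : ∀ r η y → (r + η * y) * (r + η * y) ≡ (r * r + (2ℚ * η) * (r * y)) + (η * η) * (y * y)
    expand = solve 3 (λ r η y → (r :+ η :* y) :* (r :+ η :* y)
        := (r :* r :+ (con 2ℚ :* η) :* (r :* y)) :+ (η :* η) :* (y :* y)) refl
      where open +-*-Solver
  identity : ∀ R e η X F μ β → R ≡ (η * η) * X + ((R + (2ℚ * η) * (F - μ * X) + (η * η) * X)
      + (2ℚ * η) * ((β * X - F) + (μ - (β + η)) * X))
  identity = solve 7 (λ R e η X F μ β → R := (η :* η) :* X :+ ((R :+ (con 2ℚ :* η) :* (F :- μ :* X)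
      :+ (η :* η) :* X) :+ (con 2ℚ :* η) :* ((β :* X :- F) :+ (μ :- (β :+ η)) :* X))) refl
    where open +-*-Solver

square-mono : ∀ {p q} → 0ℚ ≤ p → p ≤ q → p * p ≤ q * q
square-mono {p} {q} 0≤p p≤q = ℚ.≤-trans (ℚ.*-monoˡ-≤-nonNeg p {{nonNegative 0≤p}} p≤q)
  (ℚ.*-monoʳ-≤-nonNeg q {{nonNegative (ℚ.≤-trans 0≤p p≤q)}} p≤q)

close-to-0 : ∀ {p ε} → ∣ p ∣ < ε → Close ε p 0ℚ
close-to-0 {p} {ε} = subst (λ z → ∣ z ∣ < ε) (minus-0 p)
  where
  minus-0 : ∀ p → p ≡ p - 0ℚ
  minus-0 = solve 1 (λ p → p := p :- con 0ℚ) refl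
    where open +-*-Solver

-- The residuals of an eigenvector tend to 0, so by `residual-bound` all its entries do, and it
-- would be the zero vector.
no-eigenvector : ∀ G {β η} (μ : ℝ) → (∀ y → adjacency-form G y ≤ β * ∑ (λ a → y a * y a)) →
  0ℚ < η → Eventually (λ m → β + η ≤ seq μ m) → ¬ IsEigenvalue (Graph.adjacencyMatrix G) μ
no-eigenvector G {β} {η} μ rayleigh 0<η (N₀ , large) (v , v≉0 , eigen) = v≉0 λ i ε 0<ε →
  vanishes i ε 0<ε (small-square 0<η 0<ε (order G))
  where
  y : ℕ → Fin (order G) → ℚ
  y m a = seq (v a) m
  r : ℕ → Fin (order G) → ℚ
  r m a = ∑ (λ b → A[ G ] a b * y m b) - seq μ m * y m a
  vanishes : ∀ i ε → 0ℚ < ε → (∃ λ ρ → 0ℚ < ρ × ι (order G) * (ρ * ρ) < (η * ε) * (η * ε)) →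
    Eventually (λ m → Close ε (y m i) 0ℚ)
  vanishes i ε 0<ε (ρ , 0<ρ , small) = close (eventually-all {P = Residual} (λ a → eigen a ρ 0<ρ))
    where
    Residual : Fin (order G) → ℕ → Set
    Residual a m = Close ρ (seq ((Graph.adjacencyMatrix G · v) a) m) (seq (μ *ᴿ v a) m)
    close : Eventually (λ m → ∀ a → Residual a m) → Eventually (λ m → Close ε (y m i) 0ℚ)
    close (N₁ , residual) = N₀ ℕ.⊔ N₁ , λ m ≤m →
      close-to-0 (ℚ.≰⇒> λ ε≤y → ℚ.<-irrefl refl
        (too-large m (ℕ.m⊔n≤o⇒m≤o N₀ N₁ ≤m) (ℕ.m⊔n≤o⇒n≤o N₀ N₁ ≤m) ε≤y))
      where
      too-large : ∀ m → N₀ ℕ.≤ m → N₁ ℕ.≤ m → ε ≤ ∣ y m i ∣ → (η * ε) * (η * ε) < (η * ε) * (η * ε)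
      too-large m N₀≤m N₁≤m ε≤y = begin-strict
        (η * ε) * (η * ε)                  ≡⟨ regroup η ε ⟩
        (η * η) * (ε * ε)                  ≤⟨ η²-mono (square-mono (ℚ.<⇒≤ 0<ε) ε≤y) ⟩
        (η * η) * (∣ y m i ∣ * ∣ y m i ∣)  ≡⟨ cong ((η * η) *_) (∣p∣²≡p² (y m i)) ⟩
        (η * η) * (y m i * y m i)          ≤⟨ η²-mono (entry≤∑ (λ a → 0≤p² (y m a)) i) ⟩
        (η * η) * ∑ (λ a → y m a * y m a)  ≤⟨ residual-bound G {β} {η} {seq μ m} rayleigh 0<η
            (large m N₀≤m) (y m) ⟩
        ∑ (λ a → r m a * r m a)            ≤⟨ ∑-mono (λ a → r²≤ρ² a) ⟩
        ∑ {order G} (λ _ → ρ * ρ)          ≡⟨ ∑-const (order G) (ρ * ρ) ⟩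
        ι (order G) * (ρ * ρ)              <⟨ small ⟩
        (η * ε) * (η * ε)                  ∎
        where
        open ℚ.≤-Reasoning
        η²-mono : ∀ {p q} → p ≤ q → (η * η) * p ≤ (η * η) * q
        η²-mono = ℚ.*-monoˡ-≤-nonNeg (η * η) {{nonNegative (0≤p² η)}}
        regroup : ∀ η ε → (η * ε) * (η * ε) ≡ (η * η) * (ε * ε)
        regroup = solve 2 (λ η ε → (η :* ε) :* (η :* ε) := (η :* η) :* (ε :* ε)) refl
          where open +-*-Solver
        r²≤ρ² : ∀ a → r m a * r m a ≤ ρ * ρ
        r²≤ρ² a = subst (_≤ ρ * ρ) (∣p∣²≡p² (r m a)) (square-mono (ℚ.0≤∣p∣ (r m a))
          (ℚ.<⇒≤ (subst (λ z → Close ρ z (seq μ m * y m a)) (seq-· G v a m) (residual m N₁≤m a))))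

close⇒< : ∀ p q {ε} → Close ε p q → p < q + ε
close⇒< p q {ε} close = begin-strict
  p             ≡⟨ split p q ⟩
  q + (p - q)   ≤⟨ ℚ.+-monoʳ-≤ q (p≤∣p∣ (p - q)) ⟩
  q + ∣ p - q ∣ <⟨ ℚ.+-monoʳ-< q close ⟩
  q + ε         ∎
  where
  open ℚ.≤-Reasoning
  split : ∀ p q → p ≡ q + (p - q)
  split = solve 2 (λ p q → p := q :+ (p :- q)) refl
    where open +-*-Solver

-- The eigenvector is only known not to be zero, so no lower bound on its entries is
-- available; instead one entry of the Cauchy sequence decides which alternative to refute.
eigenvalue-bound : ∀ G {β η} (μ : ℝ) → (∀ y → adjacency-form G y ≤ β * ∑ (λ a → y a * y a)) →
  0ℚ < η → IsEigenvalue (Graph.adjacencyMatrix G) μ → Eventually (λ m → seq μ m < β + (η + η + η))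
eigenvalue-bound G {β} {η} μ rayleigh 0<η eigen = from (cauchy μ η 0<η)
  where
  Bounded : Set
  Bounded = Eventually (λ m → seq μ m < β + (η + η + η))
  identity : ∀ p q β η → p ≡ (β + η) + ((q - (β + (η + η))) + ((p + η) - q))
  identity = solve 4 (λ p q β η → p := (β :+ η) :+ ((q :- (β :+ (η :+ η))) :+ ((p :+ η) :- q))) refl
    where open +-*-Solver
  from : Settles η (seq μ) → Bounded
  -- Later terms stay within η of this one, so the threshold β + 2η separates two safe outcomes:
  -- below β + 3η from then on, or at least β + η from then on.
  from (N , settles) = decide (seq μ N ℚ.<? β + (η + η))
    where
    decide : Dec (seq μ N < β + (η + η)) → Bounded
    decide (yes below) = N , λ m N≤m → begin-strict
      seq μ m              <⟨ close⇒< (seq μ m) (seq μ N) (settles m N N≤m ℕ.≤-refl) ⟩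
      seq μ N + η          <⟨ ℚ.+-monoˡ-< η below ⟩
      β + (η + η) + η      ≡⟨ ℚ.+-assoc β (η + η) η ⟩
      β + (η + η + η)      ∎
      where open ℚ.≤-Reasoning
    decide (no ¬below) = contradiction eigen (no-eigenvector G {β} {η} μ rayleigh 0<η (N , λ m N≤m →
      ≤-by ((seq μ N - (β + (η + η))) + ((seq μ m + η) - seq μ N))
        (0≤+ (≤⇒0≤- (ℚ.≮⇒≥ ¬below))
             (≤⇒0≤- (ℚ.<⇒≤ (close⇒< (seq μ N) (seq μ m) (settles N m ℕ.≤-refl N≤m)))))
        (identity (seq μ m) (seq μ N) β η)))

-- Strict separation of the spectral radius from the degree

theorem1p8 : (k : ℕ) → .{{_ : NonZero k}} → (Δ : ℕ) (G : Graph) →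
    Connected[ k ] G → Regular Δ G →
    (H : Subgraph G) → IsProper H →
    (λ₁ : ℝ) → IsSpectralRadius (Subgraph.graph H) λ₁ →
    fromℚ (bound (order G) Δ k {{Graph.nonempty G}}) <ᴿ fromℕ Δ -ᴿ λ₁
theorem1p8 k Δ G connected regular H proper λ₁ (eigen , _) = η , 0<η , proj₁ eventually , λ m N≤m →
  subst (λ z → c + η < z - seq λ₁ m) (sym (fromℕ≡ι Δ m)) (separate m (proj₂ eventually m N≤m))
  where
  instance
    _ = Graph.nonempty G
    k²-nonZero : NonZero (k ℕ.^ 2)
    k²-nonZero = ℕ.m^n≢0 k 2
    den-nonZero : NonZero (denominator (order G) Δ k)
    den-nonZero = denominator-nonZero (order G) Δ k
  c γ η : ℚ
  c = bound (order G) Δ k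
  γ = c + ¼ * (c * c)
  -- A quarter of the margin c²/4: the loss of 3η in `eigenvalue-bound` leaves γ - 3η = c + η, and
  -- the last η witnesses strictness.
  η = (¼ * ¼) * (c * c)
  c-positive : Positive c
  c-positive = ℚ.normalize-pos (k ℕ.^ 2) (denominator (order G) Δ k)
  η-positive : Positive η
  η-positive = ℚ.pos*pos⇒pos (¼ * ¼) (c * c) {{ℚ.pos*pos⇒pos c {{c-positive}} c {{c-positive}}}}
  0<η : 0ℚ < η
  0<η = ℚ.positive⁻¹ η {{η-positive}}
  c*den : c * ι (denominator (order G) Δ k) ≡ ι k * ι k
  c*den = trans (fraction-* (k ℕ.^ 2) (denominator (order G) Δ k))
            (trans (cong (λ j → ι (k ℕ.* j)) (ℕ.*-identityʳ k)) (ι-* k k))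
  rayleigh : ∀ y → adjacency-form (Subgraph.graph H) y ≤ (ι Δ - γ) * ∑ (λ a → y a * y a)
  rayleigh = subgraph-form k (ℕ.>-nonZero⁻¹ k) Δ G connected regular H proper
    (ℚ.<⇒≤ (ℚ.positive⁻¹ c {{c-positive}})) c*den (0<ι (ℕ.>-nonZero⁻¹ (denominator (order G) Δ k)))
  eventually : Eventually (λ m → seq λ₁ m < (ι Δ - γ) + (η + η + η))
  eventually = eigenvalue-bound (Subgraph.graph H) {ι Δ - γ} {η} λ₁ rayleigh 0<η eigen
  separate : ∀ m → seq λ₁ m < (ι Δ - γ) + (η + η + η) → c + η < ι Δ - seq λ₁ m
  separate m less = begin-strict
    c + η                                         ≡⟨ identity c (ι Δ) ⟩
    ι Δ - ((ι Δ - γ) + (η + η + η))               <⟨ ℚ.+-monoʳ-< (ι Δ) (ℚ.neg-antimono-< less) ⟩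
    ι Δ - seq λ₁ m                                ∎
    where
    open ℚ.≤-Reasoning
    identity : ∀ c d → c + (¼ * ¼) * (c * c) ≡ d - ((d - (c + ¼ * (c * c))) + ((¼ * ¼) * (c * c)
        + (¼ * ¼) * (c * c) + (¼ * ¼) * (c * c)))
    identity = solve 2 (λ c d → c :+ (con ¼ :* con ¼) :* (c :* c)
        := d :- ((d :- (c :+ con ¼ :* (c :* c))) :+ ((con ¼ :* con ¼) :* (c :* c)
        :+ (con ¼ :* con ¼) :* (c :* c) :+ (con ¼ :* con ¼) :* (c :* c)))) refl
      where open +-*-Solver
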